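{- For every integer $n\ge 0$, $$\sum_{\lambda\in\mathcal{PDO}(2n)} x^{\ell_d(\lambda)} = \sum_{k=0}^{n}\left(\sum_{\mu\in\mathcal{PDO}(k)}x^{\ell_d(\mu)}\right)\left(\sum_{\nu\in\mathcal{PDO}(n-k)}x^{\ell_d(\nu)}\right)$$ as polynomials in $x$. Equivalently, writing $PDO(x,q):=\sum_{\lambda\in\mathcal{PDO}}x^{\ell_d(\lambda)}q^{|\lambda|}$, we have for all $n\ge 0$ $$[q^{2n}]\,PDO(x,q) = [q^n]\left(PDO(x,q)\right)^2.$$
   Context: A PDO partition (partition into odd parts with designated summands) of a nonnegative integer $n$ is an integer partition of $n$ all of whose parts are odd, together with a choice, for each part size that occurs, of exactly one of its occurrences (the "designated" one). Occurrences of the same part size are distinguished by position, so a part size occurring $t$ times can be designated in $t$ ways; e.g. $1'+1$ and $1+1'$ are two different PDO partitions of $2$. The weight $|\lambda|$ is the sum of all parts of $\lambda$. $\mathcal{PDO}(n)$ is the set of all PDO partitions of $n$, with $\mathcal{PDO}(0)$ consisting of the empty partition only, and $\mathcal{PDO}:=\bigcup_{n\ge0}\mathcal{PDO}(n)$. For $\lambda\in\mathcal{PDO}$, $\ell_d(\lambda)$ is the number of different part sizes occurring in $\lambda$. $[q^n]F$ denotes the coefficient of $q^n$ in the formal power series $F$ in $q$ (here with coefficients in $\mathbb{Z}[x]$). -}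

module Defs where

open import Data.Bool using (Bool; true; false)
import Data.Bool.Properties as Bool
open import Data.Empty using (⊥)
open import Data.Integer using (ℤ; 0ℤ; 1ℤ) renaming (_+_ to _+ℤ_; _*_ to _*ℤ_)
open import Data.List using (List; []; _∷_; _++_; map; foldr; filter; length; deduplicate; upTo)
open import Data.List.Membership.Propositional using (_∈_)
open import Data.List.Membership.Propositional.Properties using (∈-map⁺; ∈-map⁻; ∈-++⁺ˡ; ∈-++⁺ʳ; ∈-++⁻; ∈-filter⁺; ∈-filter⁻)
open import Data.List.Relation.Unary.All using (All; []; _∷_; all?)
open import Data.List.Relation.Unary.Any using (here)
open import Data.List.Relation.Unary.AllPairs using ([]; _∷_)
open import Data.List.Relation.Unary.Linked using (Linked; linked?)
open import Data.List.Relation.Unary.Unique.Propositional using (Unique)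
import Data.List.Relation.Unary.Unique.Propositional.Properties as Unique
open import Data.Nat using (ℕ; zero; suc; _∸_; _≤_; _<_; _≥_; z≤n; s≤s; z<s; _≟_; _≥?_)
open import Data.Nat.Divisibility using (_∤_; _∣?_; _∣0)
open import Data.Nat.ListAction using (sum)
open import Data.Nat.Properties using (≤-reflexive)
open import Data.Product using (_×_; _,_; proj₁; proj₂)
open import Data.Product.Properties using (≡-dec)
open import Data.Sum using (inj₁; inj₂)
open import Function.Base using (_∘_)
open import Function.Bundles using (_⇔_; mk⇔)
open import Relation.Binary.Definitions using (DecidableEquality)
open import Relation.Binary.PropositionalEquality using (_≡_; refl)
open import Relation.Nullary using (contradiction)
open import Relation.Nullary.Decidable using (¬?; _×-dec_; map′)
open import Relation.Unary using (Decidable)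

-- One occurrence of a part: its size, and whether this occurrence is the
-- designated one.
Occurrence : Set
Occurrence = ℕ × Bool

_≟ᵒ_ : DecidableEquality Occurrence
_≟ᵒ_ = ≡-dec _≟_ Bool._≟_

parts : List Occurrence → List ℕ
parts = map proj₁

weight : List Occurrence → ℕ
weight = sum ∘ parts

designations : ℕ → List Occurrence → ℕ
designations p λs = length (filter (_≟ᵒ (p , true)) λs)

-- Parts are listed in weakly decreasing order and designation is a flag on a
-- position, so 1′+1 and 1+1′ are different lists.  Positivity of the parts
-- follows from their being odd.
record IsPDO (λs : List Occurrence) : Set where
  constructor mkPDO
  field
    decreasing : Linked _≥_ (parts λs)
    odd        : All (2 ∤_) (parts λs)
    designated : All (λ p → designations p λs ≡ 1) (parts λs)

isPDO? : Decidable IsPDO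
isPDO? λs = map′ (λ (a , b , c) → mkPDO a b c)
                 (λ (mkPDO a b c) → a , b , c)
                 (linked? _≥?_ (parts λs)
                   ×-dec all? (λ p → ¬? (2 ∣? p)) (parts λs)
                   ×-dec all? (λ p → designations p λs ≟ 1) (parts λs))

IsPDOOf : ℕ → List Occurrence → Set
IsPDOOf n λs = IsPDO λs × weight λs ≡ n

isPDOOf? : ∀ n → Decidable (IsPDOOf n)
isPDOOf? n λs = isPDO? λs ×-dec (weight λs ≟ n)

ℓd : List Occurrence → ℕ
ℓd = length ∘ deduplicate _≟_ ∘ parts

incrementHead : List Occurrence → List Occurrence
incrementHead []             = []
incrementHead ((p , b) ∷ λs) = (suc p , b) ∷ λs

-- All lists of occurrences with positive parts and weight at most n.
candidates : ℕ → List (List Occurrence)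
candidates zero    = [] ∷ []
candidates (suc n) = map ((1 , true) ∷_) (candidates n)
                  ++ map ((1 , false) ∷_) (candidates n)
                  ++ map incrementHead (candidates n)

-- The finite set of PDO partitions of n, as a list; ∈-PDO and PDO-unique
-- show that it contains each of them exactly once.
PDO : ℕ → List (List Occurrence)
PDO n = filter (isPDOOf? n) (candidates n)

private
  Positive : List Occurrence → Set
  Positive = All (0 <_) ∘ parts

  odd⇒positive : ∀ {ps} → All (2 ∤_) ps → All (0 <_) ps
  odd⇒positive []                = []
  odd⇒positive (_∷_ {zero} o _)  = contradiction (2 ∣0) o
  odd⇒positive (_∷_ {suc _} _ r) = z<s ∷ odd⇒positive r

  candidates-complete : ∀ n λs → Positive λs → weight λs ≤ n → λs ∈ candidates n
  candidates-complete zero    []                        _        _       = here refl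
  candidates-complete zero    ((suc _ , _) ∷ _)         _        ()
  candidates-complete zero    ((zero , _) ∷ _)          (() ∷ _) _
  candidates-complete (suc n) []                        _        _       =
    ∈-++⁺ʳ (map _ (candidates n)) (∈-++⁺ʳ (map _ (candidates n))
      (∈-map⁺ incrementHead (candidates-complete n [] [] z≤n)))
  candidates-complete (suc n) ((zero , _) ∷ _)          (() ∷ _) _
  candidates-complete (suc n) ((1 , true) ∷ λs)         (_ ∷ ps) (s≤s w) =
    ∈-++⁺ˡ (∈-map⁺ _ (candidates-complete n λs ps w))
  candidates-complete (suc n) ((1 , false) ∷ λs)        (_ ∷ ps) (s≤s w) =
    ∈-++⁺ʳ (map _ (candidates n)) (∈-++⁺ˡ (∈-map⁺ _ (candidates-complete n λs ps w)))
  candidates-complete (suc n) ((suc (suc p) , b) ∷ λs)  (_ ∷ ps) (s≤s w) =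
    ∈-++⁺ʳ (map _ (candidates n)) (∈-++⁺ʳ (map _ (candidates n))
      (∈-map⁺ incrementHead (candidates-complete n ((suc p , b) ∷ λs) (z<s ∷ ps) w)))

  candidates-positive : ∀ n {λs} → λs ∈ candidates n → Positive λs
  candidates-positive zero    (here refl) = []
  candidates-positive (suc n) m with ∈-++⁻ (map ((1 , true) ∷_) (candidates n)) m
  ... | inj₁ m₁ with ∈-map⁻ _ m₁
  ...   | _ , k , refl = z<s ∷ candidates-positive n k
  candidates-positive (suc n) m | inj₂ m₂ with ∈-++⁻ (map ((1 , false) ∷_) (candidates n)) m₂
  ... | inj₁ m₃ with ∈-map⁻ _ m₃
  ...   | _ , k , refl = z<s ∷ candidates-positive n k
  candidates-positive (suc n) m | inj₂ m₂ | inj₂ m₄ with ∈-map⁻ incrementHead m₄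
  ...   | []    , k , refl = []
  ...   | _ ∷ _ , k , refl with candidates-positive n k
  ...     | _ ∷ ps = z<s ∷ ps

  incrementHead-injective : ∀ {xs ys} → incrementHead xs ≡ incrementHead ys → xs ≡ ys
  incrementHead-injective {[]}    {[]}    _    = refl
  incrementHead-injective {[]}    {_ ∷ _} ()
  incrementHead-injective {_ ∷ _} {[]}    ()
  incrementHead-injective {_ ∷ _} {_ ∷ _} refl = refl

  1∉incremented : ∀ n {b λs} → (1 , b) ∷ λs ∈ map incrementHead (candidates n) → ⊥
  1∉incremented n m with ∈-map⁻ incrementHead m
  ... | [] , _ , ()
  ... | (zero , _) ∷ _ , k , refl with candidates-positive n k
  ...   | () ∷ _

  candidates-unique : ∀ n → Unique (candidates n)
  candidates-unique zero    = [] ∷ []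
  candidates-unique (suc n) =
    Unique.++⁺ (Unique.map⁺ (λ { refl → refl }) ih)
      (Unique.++⁺ (Unique.map⁺ (λ { refl → refl }) ih)
                  (Unique.map⁺ incrementHead-injective ih)
                  disjoint₂)
      disjoint₁
    where
    ih = candidates-unique n

    disjoint₂ : ∀ {λs} → λs ∈ map ((1 , false) ∷_) (candidates n)
                       × λs ∈ map incrementHead (candidates n) → ⊥
    disjoint₂ (m , m′) with ∈-map⁻ _ m
    ... | _ , _ , refl = 1∉incremented n m′

    disjoint₁ : ∀ {λs} → λs ∈ map ((1 , true) ∷_) (candidates n)
                       × λs ∈ map ((1 , false) ∷_) (candidates n)
                           ++ map incrementHead (candidates n) → ⊥
    disjoint₁ (m , m′) with ∈-map⁻ _ m | ∈-++⁻ (map ((1 , false) ∷_) (candidates n)) m′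
    ... | _ , _ , refl | inj₂ m″ = 1∉incremented n m″
    ... | _ , _ , refl | inj₁ m″ with ∈-map⁻ _ m″
    ...   | _ , _ , ()

∈-PDO : ∀ n λs → λs ∈ PDO n ⇔ IsPDOOf n λs
∈-PDO n λs = mk⇔
  (λ m → proj₂ (∈-filter⁻ (isPDOOf? n) {xs = candidates n} m))
  (λ (p , w) → ∈-filter⁺ (isPDOOf? n)
    (candidates-complete n λs (odd⇒positive (IsPDO.odd p)) (≤-reflexive w)) (p , w))

PDO-unique : ∀ n → Unique (PDO n)
PDO-unique n = Unique.filter⁺ (isPDOOf? n) (candidates-unique n)

-- Coefficient lists, constant term first.  Trailing zeros are allowed, so
-- equality of polynomials is _≈_ rather than _≡_.
Poly : Set
Poly = List ℤ

coeff : Poly → ℕ → ℤ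
coeff []      _       = 0ℤ
coeff (a ∷ p) zero    = a
coeff (a ∷ p) (suc m) = coeff p m

infix 4 _≈_
_≈_ : Poly → Poly → Set
p ≈ q = ∀ m → coeff p m ≡ coeff q m

infixl 6 _⊕_
_⊕_ : Poly → Poly → Poly
[]      ⊕ q       = q
(a ∷ p) ⊕ []      = a ∷ p
(a ∷ p) ⊕ (b ∷ q) = (a +ℤ b) ∷ (p ⊕ q)

infixl 7 _⊗_
_⊗_ : Poly → Poly → Poly
[]      ⊗ q = []
(a ∷ p) ⊗ q = map (a *ℤ_) q ⊕ (0ℤ ∷ (p ⊗ q))

x^_ : ℕ → Poly
x^ zero  = 1ℤ ∷ []
x^ suc k = 0ℤ ∷ (x^ k)

∑ : {A : Set} → List A → (A → Poly) → Poly
∑ as f = foldr _⊕_ [] (map f as)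

syntax ∑ as (λ a → p) = ∑[ a ∈ as ] p

-- ℤ[x]⟦q⟧: the value at n is the coefficient of qⁿ.
Series : Set
Series = ℕ → Poly

[q^_]_ : ℕ → Series → Poly
[q^ n ] F = F n

infixl 7 _⊛_
_⊛_ : Series → Series → Series
(F ⊛ G) n = ∑[ k ∈ upTo (suc n) ] (F k ⊗ G (n ∸ k))

-- ∑_λ x^{ℓd λ} q^{|λ|} over all PDO partitions λ, grouped by |λ|.
PDOSeries : Series
PDOSeries n = ∑[ μ ∈ PDO n ] (x^ ℓd μ)

{-# OPTIONS --safe #-}

-- Put y = x − 2 and G(y) = ∏_{m odd} (1 + y q^m + q^{2m}).  A part size m
-- contributes 1 + x q^m/(1 − q^m)² = (1 + y q^m + q^{2m})/(1 − q^m)², so the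
-- generating function is D = G(y)/G(−2).  By the Jacobi triple product,
-- G(y) = b θ(u) with b independent of y, where θ(u) = Σ_{k∈ℤ} u_k q^{k²} for any
-- solution u of u_{k+1} + u_{k−1} = y u_k with u_0 = 1; for y = −2 take
-- ε_k = (−1)^k.  Hence D θ(ε) = θ(u).  Multiply by θ(1) and take even parts.
-- Substituting (k , l) ↦ (k + l , k − l) turns the even part of θ(u) θ(1) into
-- θ(u)², and θ(ε) θ(1) is even, so (even part of D) θ(ε)² = θ(u)² = D² θ(ε)².
-- For each N all of this holds for finite sums and products modulo q^{2N+1}
-- (q^{N+1} for even parts), with b the central Gaussian binomial [2N choose N].

module Submission where

open import Algebra.Bundles using (CommutativeRing)
import Algebra.Solver.Ring.NaturalCoefficients.Default as SemiringSolver
open import Data.Bool using (if_then_else_; true; false)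
open import Data.Empty using (⊥)
open import Data.Integer as ℤ using (ℤ; +_; -[1+_]; ∣_∣; 0ℤ; 1ℤ; -1ℤ)
open import Data.Integer.Divisibility.Signed as ℤ∣ using ()
import Data.Integer.Properties as ℤ
import Data.Integer.Tactic.RingSolver as ℤSolver
open import Data.List using (List; []; _∷_; _++_; map; filter; length; deduplicate; upTo; applyUpTo; cartesianProduct)
open import Data.List.Membership.Propositional using (_∈_)
open import Data.List.Membership.Propositional.Properties
  using ( ∈-map⁺; ∈-map⁻; ∈-++⁺ˡ; ∈-++⁺ʳ; ∈-++⁻; ∈-filter⁺; ∈-filter⁻; ∈-deduplicate⁻; ∈-upTo⁺
        ; ∈-cartesianProduct⁺; ∈-cartesianProduct⁻)
open import Data.List.Membership.Propositional.Properties.WithK using (unique∧set⇒bag)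
open import Data.List.Properties using (map-upTo; filter-all; filter-idem; filter-reject; filter-accept)
open import Data.List.Relation.Binary.BagAndSetEquality using (∼bag⇒↭)
open import Data.List.Relation.Binary.Permutation.Propositional as ↭ using (_↭_)
open import Data.List.Relation.Unary.All as All using (All; []; _∷_)
open import Data.List.Relation.Unary.AllPairs using ([])
open import Data.List.Relation.Unary.Any using (here; there)
open import Data.List.Relation.Unary.Linked using (Linked; []; [-]; _∷_)
open import Data.List.Relation.Unary.Linked.Properties using (Linked⇒All)
open import Data.List.Relation.Unary.Unique.Propositional using (Unique)
import Data.List.Relation.Unary.Unique.Propositional.Properties as Unique
open import Data.Nat as ℕ using (ℕ; zero; suc; _≥_)
open import Data.Nat.Divisibility using (_∣_; _∤_; ∣m+n∣m⇒∣n; m∣m*n; _∣0; ∣1⇒≡1)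
open import Data.Nat.Primality using (euclidsLemma; prime[2])
import Data.Nat.Properties as ℕ
import Data.Nat.Tactic.RingSolver as ℕSolver
open import Data.Product using (_×_; _,_; proj₁; proj₂; ∃)
open import Data.Sum using (_⊎_; [_,_]′; inj₁; inj₂)
open import Data.Unit using (⊤; tt)
open import Function.Base using (id; _∘_; case_of_)
open import Function.Bundles using (_⇔_; mk⇔; Equivalence)
open import Relation.Binary.PropositionalEquality as ≡ using (_≡_; _≢_)
open import Relation.Nullary using (¬_; does; yes; no; contradiction; ¬?)
open import Relation.Unary using (Decidable)
open import Algebra.Properties.AbelianGroup ℤ.+-0-abelianGroup using () renaming (∙-cancelʳ to +-cancelʳ)

open Equivalence using (to; from)

-- Finite sums and formal power series

-- The usual variable z with z + 1/z = y is not adjoined. It is replaced by the shift E acting on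
-- solutions of the recurrence, so everything stays over the given coefficient ring. The triple
-- product then reads b θ(v) = G(y) v_0 for every solution v, whatever its value at 0. This freedom
-- is what produces θ(u)²: after the rotation the inner sum over l has coefficients u_{k+l}, a
-- shifted solution with value u_k at 0, so it equals θ(u) u_k, and the outer sum over k is θ(u)
-- once more.
--
-- The obstacle is that taking even parts is not multiplicative. It is only linear over series in
-- q², and θ(ε) is not such a series. The factor θ(1) repairs this: if a² + b² is odd, exchanging a
-- and b negates ε_a, so odd coefficients of θ(ε) θ(1) equal their own negatives. Here the absence
-- of 2-torsion enters.
--
-- Neither infinite products nor inverse series occur. Quotients are cross-multiplied, and factors
-- with constant term 1 are cancelled coefficient by coefficient. For the coefficient of index N of
-- the even part, truncation level N suffices.

module Sums {c ℓ} (R : CommutativeRing c ℓ) where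
  open CommutativeRing R
  open import Relation.Binary.Reasoning.Setoid setoid
  open SemiringSolver commutativeSemiring using (solve; _:=_; _:+_)
  open import Algebra.Properties.Ring ring using (-0#≈0#; -‿+-comm)

  Σ[_] : {A : Set} → List A → (A → Carrier) → Carrier
  Σ[ [] ] f = 0#
  Σ[ a ∷ as ] f = f a + Σ[ as ] f

  -- ∑_{a+b=n} f a b
  diag : ℕ → (ℕ → ℕ → Carrier) → Carrier
  diag zero    f = f 0 0
  diag (suc n) f = f 0 (suc n) + diag n (λ a → f (suc a))

  diag-cong : ∀ n {f g} → (∀ a b → a ℕ.+ b ≡ n → f a b ≈ g a b) → diag n f ≈ diag n g
  diag-cong zero    e = e 0 0 ≡.refl
  diag-cong (suc n) e = +-cong (e 0 (suc n) ≡.refl) (diag-cong n λ a b p → e (suc a) b (≡.cong suc p))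

  private
    interchange : ∀ a b c d → (a + b) + (c + d) ≈ (a + c) + (b + d)
    interchange = solve 4 (λ a b c d → (a :+ b) :+ (c :+ d) := (a :+ c) :+ (b :+ d)) refl

  diag-+ : ∀ n f g → diag n (λ a b → f a b + g a b) ≈ diag n f + diag n g
  diag-+ zero    f g = refl
  diag-+ (suc n) f g = trans (+-congˡ (diag-+ n _ _)) (interchange _ _ _ _)

  diag-*ˡ : ∀ n s f → diag n (λ a b → s * f a b) ≈ s * diag n f
  diag-*ˡ zero    s f = refl
  diag-*ˡ (suc n) s f = trans (+-congˡ (diag-*ˡ n s _)) (sym (distribˡ s _ _))

  diag-0 : ∀ n → diag n (λ _ _ → 0#) ≈ 0#
  diag-0 zero    = refl
  diag-0 (suc n) = trans (+-identityˡ _) (diag-0 n)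

  diag-last : ∀ n f → diag (suc n) f ≈ diag n (λ a b → f a (suc b)) + f (suc n) 0
  diag-last zero    f = refl
  diag-last (suc n) f = trans (+-congˡ (diag-last n (λ a → f (suc a)))) (sym (+-assoc _ _ _))

  diag-swap : ∀ n f → diag n f ≈ diag n (λ a b → f b a)
  diag-swap zero    f = refl
  diag-swap (suc n) f = begin
    f 0 (suc n) + diag n (λ a → f (suc a))       ≈⟨ +-comm _ _ ⟩
    diag n (λ a → f (suc a)) + f 0 (suc n)       ≈⟨ +-congʳ (diag-swap n _) ⟩
    diag n (λ a b → f (suc b) a) + f 0 (suc n)   ≈⟨ diag-last n (λ a b → f b a) ⟨
    diag (suc n) (λ a b → f b a)                 ∎

  -- As in Pascal's triangle, each entry of diagonal n + 1 receives one contribution from each of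
  -- its two neighbours on diagonal n, and a boundary entry from its only one. Both recurrences for
  -- `rothe` are instances.
  diag-pascal : ∀ n f {l r} →
    (∀ b → f 0 (suc b) ≈ r 0 b) → (∀ a → f (suc a) 0 ≈ l a 0) →
    (∀ a b → f (suc a) (suc b) ≈ l a (suc b) + r (suc a) b) →
    diag (suc n) f ≈ diag n l + diag n r
  diag-pascal zero    f left right step = trans (+-cong (left 0) (right 0)) (+-comm _ _)
  diag-pascal (suc n) f {l} {r} left right step = begin
    f 0 (2 ℕ.+ n) + diag (suc n) (λ a → f (suc a))
      ≈⟨ +-cong (left (suc n)) (diag-last n (λ a → f (suc a))) ⟩
    r 0 (suc n) + (diag n (λ a b → f (suc a) (suc b)) + f (2 ℕ.+ n) 0)
      ≈⟨ +-congˡ (+-cong (trans (diag-cong n (λ a b _ → step a b)) (diag-+ n _ _)) (right (suc n))) ⟩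
    r 0 (suc n) + ((diag n (λ a b → l a (suc b)) + diag n (λ a → r (suc a))) + l (suc n) 0)
      ≈⟨ shuffle _ _ _ _ ⟩
    (diag n (λ a b → l a (suc b)) + l (suc n) 0) + (r 0 (suc n) + diag n (λ a → r (suc a)))
      ≈⟨ +-congʳ (diag-last n l) ⟨
    diag (suc n) l + diag (suc n) r ∎
    where
    shuffle : ∀ a b c d → a + ((b + c) + d) ≈ (b + d) + (a + c)
    shuffle = solve 4 (λ a b c d → a :+ ((b :+ c) :+ d) := (b :+ d) :+ (a :+ c)) refl

  Σ-cong : ∀ {A : Set} (as : List A) {f g} → (∀ a → f a ≈ g a) → Σ[ as ] f ≈ Σ[ as ] g
  Σ-cong []       e = refl
  Σ-cong (a ∷ as) e = +-cong (e a) (Σ-cong as e)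

  Σ-*ˡ : ∀ {A : Set} s (as : List A) f → Σ[ as ] (λ a → s * f a) ≈ s * Σ[ as ] f
  Σ-*ˡ s []       f = sym (zeroʳ s)
  Σ-*ˡ s (a ∷ as) f = trans (+-congˡ (Σ-*ˡ s as f)) (sym (distribˡ s _ _))

  Σ-*ʳ : ∀ {A : Set} s (as : List A) f → Σ[ as ] (λ a → f a * s) ≈ Σ[ as ] f * s
  Σ-*ʳ s as f = trans (Σ-cong as (λ a → *-comm _ _)) (trans (Σ-*ˡ s as f) (*-comm _ _))

  Σ-++ : ∀ {A : Set} (as bs : List A) f → Σ[ as ++ bs ] f ≈ Σ[ as ] f + Σ[ bs ] f
  Σ-++ []       bs f = sym (+-identityˡ _)
  Σ-++ (a ∷ as) bs f = trans (+-congˡ (Σ-++ as bs f)) (sym (+-assoc _ _ _))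

  Σ-map : ∀ {A B : Set} (h : B → A) bs f → Σ[ map h bs ] f ≡ Σ[ bs ] (λ b → f (h b))
  Σ-map h []       f = ≡.refl
  Σ-map h (b ∷ bs) f = ≡.cong (λ s → f (h b) + s) (Σ-map h bs f)

  Σ-× : ∀ {A B : Set} (as : List A) (bs : List B) f →
        Σ[ cartesianProduct as bs ] f ≈ Σ[ as ] (λ a → Σ[ bs ] (λ b → f (a , b)))
  Σ-× []       bs f = refl
  Σ-× (a ∷ as) bs f = trans (Σ-++ (map (a ,_) bs) _ f)
    (+-cong (reflexive (Σ-map (a ,_) bs f)) (Σ-× as bs f))

  Σ-*-Σ : ∀ {A B : Set} (as : List A) (bs : List B) f g →
          Σ[ as ] f * Σ[ bs ] g ≈ Σ[ cartesianProduct as bs ] (λ (a , b) → f a * g b)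
  Σ-*-Σ as bs f g = begin
    Σ[ as ] f * Σ[ bs ] g                            ≈⟨ Σ-*ʳ (Σ[ bs ] g) as f ⟨
    Σ[ as ] (λ a → f a * Σ[ bs ] g)                  ≈⟨ Σ-cong as (λ a → Σ-*ˡ (f a) bs g) ⟨
    Σ[ as ] (λ a → Σ[ bs ] (λ b → f a * g b))        ≈⟨ Σ-× as bs (λ (a , b) → f a * g b) ⟨
    Σ[ cartesianProduct as bs ] (λ (a , b) → f a * g b) ∎

  Σ-neg : ∀ {A : Set} (as : List A) f → Σ[ as ] (λ a → - f a) ≈ - Σ[ as ] f
  Σ-neg []       f = sym -0#≈0#
  Σ-neg (a ∷ as) f = trans (+-congˡ (Σ-neg as f)) (-‿+-comm _ _)

  Σ-cong-∈ : ∀ {A : Set} (as : List A) {f g} → (∀ {a} → a ∈ as → f a ≈ g a) → Σ[ as ] f ≈ Σ[ as ] g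
  Σ-cong-∈ []       e = refl
  Σ-cong-∈ (a ∷ as) e = +-cong (e (here ≡.refl)) (Σ-cong-∈ as (λ a∈as → e (there a∈as)))

  Σ-filter : ∀ {A : Set} {P : A → Set} (P? : Decidable P) as f →
             Σ[ filter P? as ] f ≈ Σ[ as ] (λ a → if does (P? a) then f a else 0#)
  Σ-filter P? []       f = refl
  Σ-filter P? (a ∷ as) f with does (P? a)
  ... | true  = +-congˡ (Σ-filter P? as f)
  ... | false = trans (Σ-filter P? as f) (sym (+-identityˡ _))

  Σ-↭ : ∀ {A : Set} {as bs : List A} (f : A → Carrier) → as ↭ bs → Σ[ as ] f ≈ Σ[ bs ] f
  Σ-↭ f ↭.refl           = refl
  Σ-↭ f (↭.prep a p)     = +-congˡ (Σ-↭ f p)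
  Σ-↭ f (↭.swap a b p)   = trans (+-congˡ (+-congˡ (Σ-↭ f p)))
    (solve 3 (λ x y z → x :+ (y :+ z) := y :+ (x :+ z)) refl (f a) (f b) _)
  Σ-↭ f (↭.trans p p′)   = trans (Σ-↭ f p) (Σ-↭ f p′)

  -- Duplicate-free lists with the same members are permutations of each other. Every combinatorial
  -- bijection of the proof becomes an identity of sums through this lemma.
  Σ-unique : ∀ {A : Set} {as bs : List A} (f : A → Carrier) → Unique as → Unique bs →
             (∀ {a} → a ∈ as ⇔ a ∈ bs) → Σ[ as ] f ≈ Σ[ bs ] f
  Σ-unique f u u′ e = Σ-↭ f (∼bag⇒↭ (unique∧set⇒bag u u′ e))

  diag-Σ : ∀ n f → diag n f ≈ Σ[ upTo (suc n) ] (λ k → f k (n ℕ.∸ k))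
  diag-Σ zero    f = sym (+-identityʳ _)
  diag-Σ (suc n) f = +-congˡ (begin
    diag n (λ a → f (suc a))                         ≈⟨ diag-Σ n _ ⟩
    Σ[ upTo (suc n) ] (λ k → f (suc k) (n ℕ.∸ k))     ≡⟨ Σ-map suc (upTo (suc n)) (λ k → f k (suc n ℕ.∸ k)) ⟨
    Σ[ map suc (upTo (suc n)) ] (λ k → f k (suc n ℕ.∸ k))
      ≡⟨ ≡.cong (λ ks → Σ[ ks ] (λ k → f k (suc n ℕ.∸ k))) (map-upTo suc (suc n)) ⟩
    Σ[ applyUpTo suc (suc n) ] (λ k → f k (suc n ℕ.∸ k)) ∎)

module PowerSeries {c ℓ} (R : CommutativeRing c ℓ) where
  open CommutativeRing R
  open Sums R
  open import Algebra.Properties.Ring ring using (-0#≈0#; +-cancelˡ)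
  open import Relation.Binary.Reasoning.Setoid setoid

  Coeffs : Set c
  Coeffs = ℕ → Carrier

  infix  4 _≋_
  infixl 6 _⊞_
  infixl 7 _⊠_

  _≋_ : Coeffs → Coeffs → Set ℓ
  F ≋ G = ∀ n → F n ≈ G n

  _⊞_ _⊠_ : Coeffs → Coeffs → Coeffs
  (F ⊞ G) n = F n + G n
  (F ⊠ G) n = diag n (λ a b → F a * G b)

  ⊟_ : Coeffs → Coeffs
  (⊟ F) n = - F n

  const : Carrier → Coeffs
  const s zero    = s
  const s (suc _) = 0#

  tail : Coeffs → Coeffs
  tail F n = F (suc n)

  q : Coeffs
  q zero    = 0#
  q (suc n) = const 1# n

  ⊠-cong : ∀ {F F′ G G′} → F ≋ F′ → G ≋ G′ → F ⊠ G ≋ F′ ⊠ G′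
  ⊠-cong e e′ n = diag-cong n λ a b _ → *-cong (e a) (e′ b)

  ⊠-comm : ∀ F G → F ⊠ G ≋ G ⊠ F
  ⊠-comm F G n = trans (diag-swap n _) (diag-cong n λ a b _ → *-comm _ _)

  ⊠-distribʳ : ∀ F G H → (G ⊞ H) ⊠ F ≋ (G ⊠ F) ⊞ (H ⊠ F)
  ⊠-distribʳ F G H n = trans (diag-cong n λ a b _ → distribʳ _ _ _) (diag-+ n _ _)

  const-⊠ : ∀ s F n → (const s ⊠ F) n ≈ s * F n
  const-⊠ s F zero    = refl
  const-⊠ s F (suc n) = begin
    s * F (suc n) + diag n (λ a b → 0# * F b) ≈⟨ +-congˡ (diag-cong n λ a b _ → zeroˡ _) ⟩
    s * F (suc n) + diag n (λ a b → 0#)       ≈⟨ +-congˡ (diag-0 n) ⟩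
    s * F (suc n) + 0#                        ≈⟨ +-identityʳ _ ⟩
    s * F (suc n)                             ∎

  -- Induction on the coefficient index with F varying: `tail (F ⊠ G)` unfolds to F 0 times
  -- `tail G`, plus `tail F ⊠ G`.
  ⊠-assoc : ∀ F G H → (F ⊠ G) ⊠ H ≋ F ⊠ (G ⊠ H)
  ⊠-assoc F G H zero    = *-assoc _ _ _
  ⊠-assoc F G H (suc n) = begin
    (F 0 * G 0) * H (suc n) + (((λ m → F 0 * G (suc m)) ⊞ (tail F ⊠ G)) ⊠ H) n
      ≈⟨ +-cong (*-assoc _ _ _) (⊠-distribʳ H _ (tail F ⊠ G) n) ⟩
    F 0 * (G 0 * H (suc n)) + (diag n (λ a b → (F 0 * G (suc a)) * H b) + ((tail F ⊠ G) ⊠ H) n)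
      ≈⟨ +-congˡ (+-cong (trans (diag-cong n λ a b _ → *-assoc _ _ _) (diag-*ˡ n (F 0) _)) (⊠-assoc (tail F) G H n)) ⟩
    F 0 * (G 0 * H (suc n)) + (F 0 * (tail G ⊠ H) n + (tail F ⊠ (G ⊠ H)) n)
      ≈⟨ +-assoc _ _ _ ⟨
    (F 0 * (G 0 * H (suc n)) + F 0 * (tail G ⊠ H) n) + (tail F ⊠ (G ⊠ H)) n
      ≈⟨ +-congʳ (distribˡ _ _ _) ⟨
    F 0 * (G 0 * H (suc n) + (tail G ⊠ H) n) + (tail F ⊠ (G ⊠ H)) n ∎

  seriesRing : CommutativeRing c ℓ
  seriesRing = record
    { Carrier = Coeffs ; _≈_ = _≋_ ; _+_ = _⊞_ ; _*_ = _⊠_ ; -_ = ⊟_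
    ; 0# = λ _ → 0# ; 1# = const 1#
    ; isCommutativeRing = record
      { isRing = record
        { +-isAbelianGroup = record
          { isGroup = record
            { isMonoid = record
              { isSemigroup = record
                { isMagma = record
                  { isEquivalence = record
                    { refl = λ n → refl ; sym = λ e n → sym (e n) ; trans = λ e e′ n → trans (e n) (e′ n) }
                  ; ∙-cong = λ e e′ n → +-cong (e n) (e′ n) }
                ; assoc = λ F G H n → +-assoc _ _ _ }
              ; identity = (λ F n → +-identityˡ _) , (λ F n → +-identityʳ _) }
            ; inverse = (λ F n → -‿inverseˡ _) , (λ F n → -‿inverseʳ _)
            ; ⁻¹-cong = λ e n → -‿cong (e n) }
          ; comm = λ F G n → +-comm _ _ }
        ; *-cong = ⊠-cong
        ; *-assoc = ⊠-assoc
        ; *-identity = identityˡ , (λ F n → trans (⊠-comm F _ n) (identityˡ F n))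
        ; distrib = (λ F G H n → trans (⊠-comm F _ n)
                      (trans (⊠-distribʳ F G H n) (+-cong (⊠-comm G F n) (⊠-comm H F n))))
                  , ⊠-distribʳ }
      ; *-comm = ⊠-comm } }
    where
    identityˡ : ∀ F → const 1# ⊠ F ≋ F
    identityˡ F n = trans (const-⊠ 1# F n) (*-identityˡ _)

  const-+ : ∀ s t → const (s + t) ≋ const s ⊞ const t
  const-+ s t zero    = refl
  const-+ s t (suc n) = sym (+-identityˡ _)

  const-* : ∀ s t → const (s * t) ≋ const s ⊠ const t
  const-* s t zero    = refl
  const-* s t (suc n) = sym (trans (const-⊠ s (const t) (suc n)) (zeroʳ s))

  const-neg : ∀ s → const (- s) ≋ ⊟ const s
  const-neg s zero    = refl
  const-neg s (suc n) = sym -0#≈0#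

  const-cong : ∀ {s t} → s ≈ t → const s ≋ const t
  const-cong e zero    = e
  const-cong e (suc n) = refl

  q-⊠-zero : ∀ F → (q ⊠ F) 0 ≈ 0#
  q-⊠-zero F = zeroˡ _

  q-⊠-suc : ∀ F n → (q ⊠ F) (suc n) ≈ F n
  q-⊠-suc F n = begin
    0# * F (suc n) + (const 1# ⊠ F) n ≈⟨ +-cong (zeroˡ _) (const-⊠ 1# F n) ⟩
    0# + 1# * F n                     ≈⟨ +-identityˡ _ ⟩
    1# * F n                          ≈⟨ *-identityˡ _ ⟩
    F n                               ∎

  infix 4 _≋[_]_
  _≋[_]_ : Coeffs → ℕ → Coeffs → Set ℓ
  F ≋[ K ] G = ∀ i → i ℕ.< K → F i ≈ G i

  ≋⇒≋[] : ∀ {F G} K → F ≋ G → F ≋[ K ] G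
  ≋⇒≋[] K e i _ = e i

  ≋[]-mono : ∀ {K L F G} → L ℕ.≤ K → F ≋[ K ] G → F ≋[ L ] G
  ≋[]-mono L≤K e i i<L = e i (ℕ.<-≤-trans i<L L≤K)

  -- R⟦q⟧/(q^K), kept on the same carrier with a coarser equality.
  truncated : ℕ → CommutativeRing c ℓ
  truncated K = record
    { Carrier = Coeffs ; _≈_ = _≋[ K ]_ ; _+_ = _⊞_ ; _*_ = _⊠_ ; -_ = ⊟_
    ; 0# = P.0# ; 1# = P.1#
    ; isCommutativeRing = record
      { isRing = record
        { +-isAbelianGroup = record
          { isGroup = record
            { isMonoid = record
              { isSemigroup = record
                { isMagma = record
                  { isEquivalence = record
                    { refl = λ i _ → refl
                    ; sym = λ e i i<K → sym (e i i<K)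
                    ; trans = λ e e′ i i<K → trans (e i i<K) (e′ i i<K) }
                  ; ∙-cong = λ e e′ i i<K → +-cong (e i i<K) (e′ i i<K) }
                ; assoc = λ F G H → ≋⇒≋[] K (P.+-assoc F G H) }
              ; identity = (λ F → ≋⇒≋[] K (P.+-identityˡ F)) , (λ F → ≋⇒≋[] K (P.+-identityʳ F)) }
            ; inverse = (λ F → ≋⇒≋[] K (P.-‿inverseˡ F)) , (λ F → ≋⇒≋[] K (P.-‿inverseʳ F))
            ; ⁻¹-cong = λ e i i<K → -‿cong (e i i<K) }
          ; comm = λ F G → ≋⇒≋[] K (P.+-comm F G) }
        -- The coefficient of index n involves only indices a and b up to n, hence below K.
        ; *-cong = λ e e′ n n<K → diag-cong n λ a b a+b≡n → *-cong
            (e a (ℕ.≤-<-trans (ℕ.m+n≤o⇒m≤o a (ℕ.≤-reflexive a+b≡n)) n<K))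
            (e′ b (ℕ.≤-<-trans (ℕ.m+n≤o⇒n≤o a (ℕ.≤-reflexive a+b≡n)) n<K))
        ; *-assoc = λ F G H → ≋⇒≋[] K (P.*-assoc F G H)
        ; *-identity = (λ F → ≋⇒≋[] K (P.*-identityˡ F)) , (λ F → ≋⇒≋[] K (P.*-identityʳ F))
        ; distrib = (λ F G H → ≋⇒≋[] K (P.distribˡ F G H)) , (λ F G H → ≋⇒≋[] K (P.distribʳ F G H)) }
      ; *-comm = λ F G → ≋⇒≋[] K (P.*-comm F G) } }
    where module P = CommutativeRing seriesRing

  -- The constant term 1 of G makes the heads of F and F′ agree. Subtracting their contribution
  -- leaves the same congruence for the tails, with modulus lowered by one power of q. At K = 0 the
  -- conclusion is vacuous, so there is no clause for it.
  ⊠-cancelʳ : ∀ K F F′ {G} → G 0 ≈ 1# → F ⊠ G ≋[ K ] F′ ⊠ G → F ≋[ K ] F′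
  ⊠-cancelʳ (suc K) F F′ {G} G₀ e = go
    where
    head : F 0 ≈ F′ 0
    head = begin
      F 0        ≈⟨ *-identityʳ _ ⟨
      F 0 * 1#   ≈⟨ *-congˡ G₀ ⟨
      F 0 * G 0  ≈⟨ e 0 ℕ.z<s ⟩
      F′ 0 * G 0 ≈⟨ *-congˡ G₀ ⟩
      F′ 0 * 1#  ≈⟨ *-identityʳ _ ⟩
      F′ 0       ∎
    go : F ≋[ suc K ] F′
    go zero    _   = head
    go (suc i) i<K = ⊠-cancelʳ K (tail F) (tail F′) G₀
      (λ j j<K → +-cancelˡ (F 0 * G (suc j)) _ _
        (trans (e (suc j) (ℕ.s<s j<K)) (+-congʳ (*-congʳ (sym head)))))
      i (ℕ.s<s⁻¹ i<K)

  open import Algebra.Properties.Semiring.Exp (CommutativeRing.semiring seriesRing) using (_^_)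

  -- A factor q^e gains e orders of precision. This later compensates for Gaussian binomials that
  -- agree only to low order.
  q^-⊠-cong : ∀ e {K F G} → F ≋[ K ] G → q ^ e ⊠ F ≋[ e ℕ.+ K ] q ^ e ⊠ G
  q^-⊠-cong zero    h i i<K = trans (const-⊠ 1# _ i) (trans (*-congˡ (h i i<K)) (sym (const-⊠ 1# _ i)))
  q^-⊠-cong (suc e) {F = F} {G} h i i<K = begin
    (q ⊠ q ^ e ⊠ F) i   ≈⟨ ⊠-assoc q (q ^ e) F i ⟩
    (q ⊠ (q ^ e ⊠ F)) i ≈⟨ step i i<K ⟩
    (q ⊠ (q ^ e ⊠ G)) i ≈⟨ ⊠-assoc q (q ^ e) G i ⟨
    (q ⊠ q ^ e ⊠ G) i   ∎
    where
    step : q ⊠ (q ^ e ⊠ F) ≋[ suc (e ℕ.+ _) ] q ⊠ (q ^ e ⊠ G)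
    step zero    _   = trans (q-⊠-zero (q ^ e ⊠ F)) (sym (q-⊠-zero (q ^ e ⊠ G)))
    step (suc i) i<K = trans (q-⊠-suc _ i) (trans (q^-⊠-cong e h i (ℕ.s<s⁻¹ i<K)) (sym (q-⊠-suc _ i)))

  q^-⊠-small : ∀ K F → q ^ K ⊠ F ≋[ K ] (λ _ → 0#)
  q^-⊠-small K F i i<K = trans
    (q^-⊠-cong K {0} {F} {λ _ → 0#} (λ _ ()) i (≡.subst (i ℕ.<_) (≡.sym (ℕ.+-identityʳ K)) i<K))
    (CommutativeRing.zeroʳ seriesRing (q ^ K) i)

  -- The conditional has the shape expected by `Σ-filter`, so extracting a coefficient of a sum of
  -- monomials becomes summing over a filtered list.
  monomial : ∀ m s j → (q ^ m ⊠ const s) j ≈ (if does (m ℕ.≟ j) then s else 0#)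
  monomial zero    s zero    = *-identityˡ s
  monomial zero    s (suc j) = trans (const-⊠ 1# (const s) (suc j)) (zeroʳ 1#)
  monomial (suc m) s zero    = trans (⊠-assoc q (q ^ m) (const s) 0) (q-⊠-zero (q ^ m ⊠ const s))
  monomial (suc m) s (suc j) = trans (⊠-assoc q (q ^ m) _ (suc j)) (trans (q-⊠-suc _ j) (monomial m s j))

  Σ-coeff : ∀ {A : Set} (as : List A) f j →
    Sums.Σ[_] seriesRing as f j ≈ Σ[ as ] (λ a → f a j)
  Σ-coeff []       f j = refl
  Σ-coeff (a ∷ as) f j = +-congˡ (Σ-coeff as f j)

-- The finite Jacobi triple product

sq : ℤ → ℕ
sq k = ∣ k ∣ ℕ.* ∣ k ∣

+sq : ∀ k → + sq k ≡ k ℤ.* k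
+sq (+ n)    = ℤ.pos-* n n
+sq -[1+ n ] = ≡.refl

-- With k = a - N, and hence b = M - k, this is 2(M - k) + (k + 1)² = 2M + 1 + k², the balance of
-- exponents in `rothe-sucˡ`.
sq-suc : ∀ a b M N → a ℕ.+ b ≡ M ℕ.+ N →
         2 ℕ.* b ℕ.+ sq (+ suc a ℤ.- + N) ≡ suc (2 ℕ.* M) ℕ.+ sq (+ a ℤ.- + N)
sq-suc a b M N a+b≡M+N = ℤ.+-injective (begin
  + (2 ℕ.* b) ℤ.+ + sq (+ suc a ℤ.- + N)
    ≡⟨ ≡.cong (ℤ._+_ (+ (2 ℕ.* b))) (+sq (+ suc a ℤ.- + N)) ⟩
  + b ℤ.+ (+ b ℤ.+ 0ℤ) ℤ.+ (1ℤ ℤ.+ + a ℤ.- + N) ℤ.* (1ℤ ℤ.+ + a ℤ.- + N)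
    -- The solver takes no hypotheses, so M is written as a + b - N until the next step.
    ≡⟨ expand (+ a) (+ b) (+ N) ⟩
  rhs (+ a ℤ.+ + b ℤ.- + N)
    ≡⟨ ≡.cong rhs (≡.trans (≡.cong (ℤ._- + N) (≡.cong +_ a+b≡M+N)) (cancel (+ M) (+ N))) ⟩
  rhs (+ M)
    ≡⟨ ≡.cong (ℤ._+_ (+ suc (2 ℕ.* M))) (+sq (+ a ℤ.- + N)) ⟨
  + suc (2 ℕ.* M) ℤ.+ + sq (+ a ℤ.- + N) ∎)
  where
  open ≡.≡-Reasoning
  rhs : ℤ → ℤ
  rhs M = 1ℤ ℤ.+ (M ℤ.+ (M ℤ.+ 0ℤ)) ℤ.+ (+ a ℤ.- + N) ℤ.* (+ a ℤ.- + N)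
  expand : ∀ a b N → b ℤ.+ (b ℤ.+ 0ℤ) ℤ.+ (1ℤ ℤ.+ a ℤ.- N) ℤ.* (1ℤ ℤ.+ a ℤ.- N)
    ≡ 1ℤ ℤ.+ ((a ℤ.+ b ℤ.- N) ℤ.+ ((a ℤ.+ b ℤ.- N) ℤ.+ 0ℤ)) ℤ.+ (a ℤ.- N) ℤ.* (a ℤ.- N)
  expand = ℤSolver.solve-∀
  cancel : ∀ M N → M ℤ.+ N ℤ.- N ≡ M
  cancel = ℤSolver.solve-∀

-- With k = a - N this is 2(k + N) + (k - 1)² = 2N + 1 + k², the balance of exponents in
-- `rothe-sucʳ`.
sq-pred : ∀ a N → 2 ℕ.* a ℕ.+ sq (+ a ℤ.- + suc N) ≡ suc (2 ℕ.* N) ℕ.+ sq (+ a ℤ.- + N)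
sq-pred a N = ℤ.+-injective (begin
  + (2 ℕ.* a) ℤ.+ + sq (+ a ℤ.- + suc N)
    ≡⟨ ≡.cong (ℤ._+_ (+ (2 ℕ.* a))) (+sq (+ a ℤ.- + suc N)) ⟩
  + a ℤ.+ (+ a ℤ.+ 0ℤ) ℤ.+ (+ a ℤ.- (1ℤ ℤ.+ + N)) ℤ.* (+ a ℤ.- (1ℤ ℤ.+ + N))
    ≡⟨ expand (+ a) (+ N) ⟩
  1ℤ ℤ.+ (+ N ℤ.+ (+ N ℤ.+ 0ℤ)) ℤ.+ (+ a ℤ.- + N) ℤ.* (+ a ℤ.- + N)
    ≡⟨ ≡.cong (ℤ._+_ (+ suc (2 ℕ.* N))) (+sq (+ a ℤ.- + N)) ⟨
  + suc (2 ℕ.* N) ℤ.+ + sq (+ a ℤ.- + N) ∎)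
  where
  open ≡.≡-Reasoning
  expand : ∀ a N → a ℤ.+ (a ℤ.+ 0ℤ) ℤ.+ (a ℤ.- (1ℤ ℤ.+ N)) ℤ.* (a ℤ.- (1ℤ ℤ.+ N))
    ≡ 1ℤ ℤ.+ (N ℤ.+ (N ℤ.+ 0ℤ)) ℤ.+ (a ℤ.- N) ℤ.* (a ℤ.- N)
  expand = ℤSolver.solve-∀

module FiniteTripleProduct {c ℓ} (R : CommutativeRing c ℓ) (q : CommutativeRing.Carrier R) where
  open CommutativeRing R hiding (zero)
  open Sums R
  open SemiringSolver commutativeSemiring using (solve; _:=_; _:+_; _:*_; con)
  open import Algebra.Properties.Semiring.Exp semiring using (_^_; ^-homo-*)
  open import Relation.Binary.Reasoning.Setoid setoid

  -- The Gaussian binomial coefficient [a+b choose a] in base q².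
  gauss : ℕ → ℕ → Carrier
  gauss zero    b       = 1#
  gauss (suc a) zero    = 1#
  gauss (suc a) (suc b) = gauss (suc a) b + q ^ (2 ℕ.* suc b) * gauss a (suc b)

  gauss-0ʳ : ∀ a → gauss a 0 ≈ 1#
  gauss-0ʳ zero    = refl
  gauss-0ʳ (suc a) = refl

  ^-+ : ∀ i j {k} → i ℕ.+ j ≡ k → q ^ i * q ^ j ≈ q ^ k
  ^-+ i j ≡.refl = sym (^-homo-* q i j)

  ^-exchange : ∀ i j k l → i ℕ.+ j ≡ k ℕ.+ l → q ^ i * q ^ j ≈ q ^ k * q ^ l
  ^-exchange i j k l e = trans (^-+ i j e) (sym (^-+ k l ≡.refl))

  -- The definition of `gauss` is one of the two q-Pascal rules and this is the other. The first
  -- serves factors with E, the second factors with E⁻¹. In the inductive step both terms are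
  -- expanded by this rule and regrouped by the definition.
  gauss-pascal : ∀ a b →
    gauss (suc a) (suc b) ≈ gauss a (suc b) + q ^ (2 ℕ.* suc a) * gauss (suc a) b
  gauss-pascal zero    zero    = refl
  gauss-pascal zero    (suc b) = begin
    gauss 1 (suc b) + q ^ (2 ℕ.* (2 ℕ.+ b)) * 1#
      ≈⟨ +-congʳ (gauss-pascal zero b) ⟩
    1# + q ^ 2 * gauss 1 b + q ^ (2 ℕ.* (2 ℕ.+ b)) * 1#
      ≈⟨ +-congˡ (*-congʳ (sym (^-+ 2 (2 ℕ.* suc b) (≡.sym (ℕ.*-distribˡ-+ 2 1 (suc b)))))) ⟩
    1# + q ^ 2 * gauss 1 b + q ^ 2 * q ^ (2 ℕ.* suc b) * 1#
      ≈⟨ solve 3 (λ p g r → con 1 :+ p :* g :+ p :* r :* con 1 := con 1 :+ p :* (g :+ r :* con 1))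
           refl (q ^ 2) (gauss 1 b) (q ^ (2 ℕ.* suc b)) ⟩
    1# + q ^ 2 * (gauss 1 b + q ^ (2 ℕ.* suc b) * 1#) ∎
  gauss-pascal (suc a) zero    = begin
    1# + q ^ 2 * gauss (suc a) 1
      ≈⟨ +-congˡ (*-congˡ (gauss-pascal a zero)) ⟩
    1# + q ^ 2 * (gauss a 1 + q ^ (2 ℕ.* suc a) * 1#)
      ≈⟨ solve 3 (λ p g r → con 1 :+ p :* (g :+ r :* con 1) := (con 1 :+ p :* g) :+ (p :* r) :* con 1)
           refl (q ^ 2) (gauss a 1) (q ^ (2 ℕ.* suc a)) ⟩
    (1# + q ^ 2 * gauss a 1) + (q ^ 2 * q ^ (2 ℕ.* suc a)) * 1#
      ≈⟨ +-congˡ (*-congʳ (^-+ 2 (2 ℕ.* suc a) (≡.sym (ℕ.*-distribˡ-+ 2 1 (suc a))))) ⟩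
    (1# + q ^ 2 * gauss a 1) + q ^ (2 ℕ.* (2 ℕ.+ a)) * 1# ∎
  gauss-pascal (suc a) (suc b) = begin
    gauss (2 ℕ.+ a) (suc b) + qB * gauss (suc a) (2 ℕ.+ b)
      ≈⟨ +-cong (gauss-pascal (suc a) b) (*-congˡ (gauss-pascal a (suc b))) ⟩
    (g + qA * g₁) + qB * (g₂ + qa * g)
      ≈⟨ solve 6 (λ g qA g₁ qB g₂ qa →
           (g :+ qA :* g₁) :+ qB :* (g₂ :+ qa :* g) := (g :+ qB :* g₂) :+ (qA :* g₁ :+ (qB :* qa) :* g))
           refl g qA g₁ qB g₂ qa ⟩
    (g + qB * g₂) + (qA * g₁ + (qB * qa) * g)
      ≈⟨ +-congˡ (+-congˡ (*-congʳ (^-exchange (2 ℕ.* (2 ℕ.+ b)) (2 ℕ.* suc a) (2 ℕ.* (2 ℕ.+ a)) (2 ℕ.* suc b) (exponents a b)))) ⟩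
    (g + qB * g₂) + (qA * g₁ + (qA * qb) * g)
      ≈⟨ +-congˡ (solve 4 (λ qA g₁ qb g → qA :* g₁ :+ (qA :* qb) :* g := qA :* (g₁ :+ qb :* g)) refl qA g₁ qb g) ⟩
    (g + qB * g₂) + qA * (g₁ + qb * g) ∎
    where
    g  = gauss (suc a) (suc b)
    g₁ = gauss (2 ℕ.+ a) b
    g₂ = gauss a (2 ℕ.+ b)
    qA = q ^ (2 ℕ.* (2 ℕ.+ a))
    qB = q ^ (2 ℕ.* (2 ℕ.+ b))
    qa = q ^ (2 ℕ.* suc a)
    qb = q ^ (2 ℕ.* suc b)
    exponents : ∀ a b → 2 ℕ.* (2 ℕ.+ b) ℕ.+ 2 ℕ.* suc a ≡ 2 ℕ.* (2 ℕ.+ a) ℕ.+ 2 ℕ.* suc b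
    exponents = ℕSolver.solve-∀

  -- The action of ∏_{j≤M} (1 + q^{2j-1} E) ∏_{j≤N} (1 + q^{2j-1} E⁻¹), with E
  -- the shift, on v at index 0.
  rothe : ℕ → ℕ → (ℤ → Carrier) → Carrier
  rothe M N v = diag (M ℕ.+ N) (λ a b → gauss a b * (q ^ sq (+ a ℤ.- + N) * v (+ a ℤ.- + N)))

  private
    pull : ∀ x g y z w → x * y ≈ w * z → ∀ v → (x * g) * (y * v) ≈ w * (g * (z * v))
    pull x g y z w e v = begin
      (x * g) * (y * v) ≈⟨ solve 4 (λ x g y v → (x :* g) :* (y :* v) := (x :* y) :* (g :* v)) refl x g y v ⟩
      (x * y) * (g * v) ≈⟨ *-congʳ e ⟩
      (w * z) * (g * v) ≈⟨ solve 4 (λ w z g v → (w :* z) :* (g :* v) := w :* (g :* (z :* v))) refl w z g v ⟩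
      w * (g * (z * v)) ∎

  -- The new factor is 1 + q^(2M+1) E. The defining Pascal rule splits each coefficient, and
  -- `sq-suc` turns the excess power of q into q^(2M+1), the same for all summands.
  rothe-sucˡ : ∀ M N v →
    rothe (suc M) N v ≈ rothe M N v + q ^ suc (2 ℕ.* M) * rothe M N (λ k → v (ℤ.suc k))
  rothe-sucˡ M N v = begin
    rothe (suc M) N v      ≈⟨ diag-pascal (M ℕ.+ N) f {l} {f} (λ b → refl) right step ⟩
    diag (M ℕ.+ N) l + rothe M N v ≈⟨ +-comm _ _ ⟩
    rothe M N v + diag (M ℕ.+ N) l ≈⟨ +-congˡ (trans (diag-cong (M ℕ.+ N) shift) (diag-*ˡ (M ℕ.+ N) _ _)) ⟩
    rothe M N v + q ^ suc (2 ℕ.* M) * rothe M N (λ k → v (ℤ.suc k)) ∎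
    where
    t : ℕ → Carrier
    t a = q ^ sq (+ a ℤ.- + N) * v (+ a ℤ.- + N)
    f l : ℕ → ℕ → Carrier
    f a b = gauss a b * t a
    l a b = (q ^ (2 ℕ.* b) * gauss a b) * t (suc a)
    right : ∀ a → gauss (suc a) 0 * t (suc a) ≈ l a 0
    right a = *-congʳ (sym (trans (*-identityˡ _) (gauss-0ʳ a)))
    step : ∀ a b → gauss (suc a) (suc b) * t (suc a) ≈ l a (suc b) + f (suc a) b
    step a b = trans (distribʳ _ _ _) (+-comm _ _)
    shift : ∀ a b → a ℕ.+ b ≡ M ℕ.+ N →
      l a b ≈ q ^ suc (2 ℕ.* M) * (gauss a b * (q ^ sq (+ a ℤ.- + N) * v (ℤ.suc (+ a ℤ.- + N))))
    shift a b e = trans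
      (pull (q ^ (2 ℕ.* b)) (gauss a b) _ _ _
        (^-exchange (2 ℕ.* b) (sq (+ suc a ℤ.- + N)) (suc (2 ℕ.* M)) (sq (+ a ℤ.- + N)) (sq-suc a b M N e)) _)
      (*-congˡ (*-congˡ (*-congˡ (reflexive (≡.cong v (ℤ.+-assoc 1ℤ (+ a) (ℤ.- (+ N))))))))

  -- The new factor is 1 + q^(2N+1) E⁻¹. Raising N also moves the origin, since position a now
  -- stands for a - N - 1; hence the summands belonging to the 1 sit at `suc a` and those belonging
  -- to E⁻¹ at `a`.
  rothe-sucʳ : ∀ M N v →
    rothe M (suc N) v ≈ rothe M N v + q ^ suc (2 ℕ.* N) * rothe M N (λ k → v (ℤ.pred k))
  rothe-sucʳ M N v = begin
    rothe M (suc N) v      ≡⟨ ≡.cong (λ n → diag n f) (ℕ.+-suc M N) ⟩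
    diag (suc (M ℕ.+ N)) f ≈⟨ diag-pascal (M ℕ.+ N) f left right step ⟩
    diag (M ℕ.+ N) l + diag (M ℕ.+ N) r
      ≈⟨ +-cong (diag-cong (M ℕ.+ N) same) (trans (diag-cong (M ℕ.+ N) shift) (diag-*ˡ (M ℕ.+ N) _ _)) ⟩
    rothe M N v + q ^ suc (2 ℕ.* N) * rothe M N (λ k → v (ℤ.pred k)) ∎
    where
    t : ℕ → Carrier
    t a = q ^ sq (+ a ℤ.- + suc N) * v (+ a ℤ.- + suc N)
    f r l : ℕ → ℕ → Carrier
    f a b = gauss a b * t a
    r a b = (q ^ (2 ℕ.* a) * gauss a b) * t a
    l a b = gauss a b * t (suc a)
    left : ∀ b → gauss 0 (suc b) * t 0 ≈ r 0 b
    left b = *-congʳ (sym (*-identityˡ _))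
    right : ∀ a → gauss (suc a) 0 * t (suc a) ≈ l a 0
    right a = *-congʳ (sym (gauss-0ʳ a))
    step : ∀ a b → gauss (suc a) (suc b) * t (suc a) ≈ l a (suc b) + r (suc a) b
    step a b = trans (*-congʳ (gauss-pascal a b)) (distribʳ _ _ _)
    same : ∀ a b → a ℕ.+ b ≡ M ℕ.+ N → l a b ≈ gauss a b * (q ^ sq (+ a ℤ.- + N) * v (+ a ℤ.- + N))
    same a b _ = reflexive (≡.cong (λ k → gauss a b * (q ^ sq k * v k)) (suc-suc (+ a) (+ N)))
      where
      suc-suc : ∀ a N → 1ℤ ℤ.+ a ℤ.- (1ℤ ℤ.+ N) ≡ a ℤ.- N
      suc-suc = ℤSolver.solve-∀
    shift : ∀ a b → a ℕ.+ b ≡ M ℕ.+ N →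
      r a b ≈ q ^ suc (2 ℕ.* N) * (gauss a b * (q ^ sq (+ a ℤ.- + N) * v (ℤ.pred (+ a ℤ.- + N))))
    shift a b _ = trans
      (pull (q ^ (2 ℕ.* a)) (gauss a b) _ _ _
        (^-exchange (2 ℕ.* a) (sq (+ a ℤ.- + suc N)) (suc (2 ℕ.* N)) (sq (+ a ℤ.- + N)) (sq-pred a N)) _)
      (*-congˡ (*-congˡ (*-congˡ (reflexive (≡.cong v (pred-suc (+ a) (+ N)))))))
      where
      pred-suc : ∀ a N → a ℤ.- (1ℤ ℤ.+ N) ≡ -1ℤ ℤ.+ (a ℤ.- N)
      pred-suc = ℤSolver.solve-∀

  -- The eigenvector equation (E + E⁻¹) v = y v. No value at 0 is prescribed, so the solutions are
  -- closed under shifts.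
  Solves : Carrier → (ℤ → Carrier) → Set ℓ
  Solves y v = ∀ k → v (ℤ.suc k) + v (ℤ.pred k) ≈ y * v k

  Solves-shift : ∀ {y v} j → Solves y v → Solves y (λ k → v (j ℤ.+ k))
  Solves-shift {y} {v} j s k = begin
    v (j ℤ.+ ℤ.suc k) + v (j ℤ.+ ℤ.pred k)
      ≡⟨ ≡.cong₂ (λ i i′ → v i + v i′) (swap j 1ℤ k) (swap j -1ℤ k) ⟩
    v (ℤ.suc (j ℤ.+ k)) + v (ℤ.pred (j ℤ.+ k)) ≈⟨ s (j ℤ.+ k) ⟩
    y * v (j ℤ.+ k) ∎
    where
    swap : ∀ j i k → j ℤ.+ (i ℤ.+ k) ≡ i ℤ.+ (j ℤ.+ k)
    swap = ℤSolver.solve-∀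

  oddProduct : ℕ → Carrier → Carrier
  oddProduct zero    y = 1#
  oddProduct (suc N) y = oddProduct N y * (1# + y * q ^ suc (2 ℕ.* N) + q ^ suc (2 ℕ.* N) * q ^ suc (2 ℕ.* N))

  -- (1 + q^{2j-1} E)(1 + q^{2j-1} E⁻¹) acts on solutions as multiplication by
  -- 1 + y q^{2j-1} + q^{4j-2}.
  oddProduct-rothe : ∀ N {y v} → Solves y v → rothe N N v ≈ oddProduct N y * v 0ℤ
  oddProduct-rothe zero    s = *-congˡ (*-identityˡ _)
  oddProduct-rothe (suc N) {y} {v} s = begin
    rothe (suc N) (suc N) v
      ≈⟨ trans (rothe-sucˡ N (suc N) v) (+-cong (rothe-sucʳ N N v) (*-congˡ (rothe-sucʳ N N (λ k → v (ℤ.suc k))))) ⟩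
    (rothe N N v + Q * rothe N N (λ k → v (ℤ.pred k)))
      + Q * (rothe N N (λ k → v (ℤ.suc k)) + Q * rothe N N (λ k → v (ℤ.suc (ℤ.pred k))))
      -- The induction hypothesis is applied to v and to its shifts, which is why the lemma ranges
      -- over all solutions.
      ≈⟨ +-cong (+-cong (oddProduct-rothe N s) (*-congˡ (oddProduct-rothe N (Solves-shift -1ℤ s))))
                (*-congˡ (+-cong (oddProduct-rothe N (Solves-shift 1ℤ s))
                                 (*-congˡ (oddProduct-rothe N (Solves-shift -1ℤ (Solves-shift 1ℤ s)))))) ⟩
    (G * v 0ℤ + Q * (G * v -1ℤ)) + Q * (G * v 1ℤ + Q * (G * v 0ℤ))
      ≈⟨ solve 5 (λ G Q a b d → (G :* a :+ Q :* (G :* b)) :+ Q :* (G :* d :+ Q :* (G :* a))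
                    := G :* ((a :+ Q :* (d :+ b)) :+ Q :* Q :* a)) refl G Q (v 0ℤ) (v -1ℤ) (v 1ℤ) ⟩
    G * ((v 0ℤ + Q * (v 1ℤ + v -1ℤ)) + Q * Q * v 0ℤ)
      ≈⟨ *-congˡ (+-congʳ (+-congˡ (*-congˡ (s 0ℤ)))) ⟩
    G * ((v 0ℤ + Q * (y * v 0ℤ)) + Q * Q * v 0ℤ)
      ≈⟨ solve 4 (λ G Q a y → G :* ((a :+ Q :* (y :* a)) :+ Q :* Q :* a)
                    := (G :* (con 1 :+ y :* Q :+ Q :* Q)) :* a) refl G Q (v 0ℤ) y ⟩
    (G * (1# + y * Q + Q * Q)) * v 0ℤ ∎
    where
    G = oddProduct N y
    Q = q ^ suc (2 ℕ.* N)

-- Representations as a sum of two squares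

-- The interval [−N , N].
box : ℕ → List ℤ
box N = map (λ a → + a ℤ.- + N) (upTo (suc (N ℕ.+ N)))

box-unique : ∀ N → Unique (box N)
box-unique N = Unique.map⁺ (λ {a} {b} e → ℤ.+-injective (+-cancelʳ (ℤ.- + N) (+ a) (+ b) e))
                           (Unique.upTo⁺ (suc (N ℕ.+ N)))

∈-box : ∀ {N} k → ∣ k ∣ ℕ.≤ N → k ∈ box N
∈-box {N} k ∣k∣≤N = ≡.subst (_∈ box N) cancel (∈-map⁺ _ (∈-upTo⁺ (bound k ∣k∣≤N)))
  where
  index : ℤ → ℕ
  index (+ n)    = n ℕ.+ N
  index -[1+ n ] = N ℕ.∸ suc n
  bound : ∀ k → ∣ k ∣ ℕ.≤ N → index k ℕ.< suc (N ℕ.+ N)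
  bound (+ n)    n≤N = ℕ.s≤s (ℕ.+-monoˡ-≤ N n≤N)
  bound -[1+ n ] _   = ℕ.s≤s (ℕ.≤-trans (ℕ.m∸n≤m N (suc n)) (ℕ.m≤m+n N N))
  index-correct : ∀ k → ∣ k ∣ ℕ.≤ N → + index k ≡ k ℤ.+ + N
  index-correct (+ n)    _   = ≡.refl
  index-correct -[1+ n ] n<N = ≡.sym (ℤ.⊖-≥ n<N)
  cancel : + index k ℤ.- + N ≡ k
  cancel = ≡.trans (≡.cong (ℤ._- + N) (index-correct k ∣k∣≤N)) (lemma k (+ N))
    where
    lemma : ∀ k N → k ℤ.+ N ℤ.- N ≡ k
    lemma = ℤSolver.solve-∀

norm : ℤ × ℤ → ℕ
norm (a , b) = sq a ℕ.+ sq b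

pairs : ℕ → List (ℤ × ℤ)
pairs N = cartesianProduct (box N) (box N)

representations : ℕ → ℕ → List (ℤ × ℤ)
representations N j = filter (λ ab → norm ab ℕ.≟ j) (pairs N)

representations-unique : ∀ N j → Unique (representations N j)
representations-unique N j =
  Unique.filter⁺ (λ ab → norm ab ℕ.≟ j) (Unique.cartesianProduct⁺ (box-unique N) (box-unique N))

norm-representation : ∀ N j {ab} → ab ∈ representations N j → norm ab ≡ j
norm-representation N j ab∈ = proj₂ (∈-filter⁻ (λ ab → norm ab ℕ.≟ j) {xs = pairs N} ab∈)

-- Since (N + 1)² exceeds 2N, the box [-N , N] holds both coordinates of every representation of a
-- number up to 2N.
square-bound : ∀ m N → m ℕ.* m ℕ.≤ N ℕ.+ N → m ℕ.≤ N
square-bound m N m²≤2N with m ℕ.≤? N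
... | yes m≤N = m≤N
... | no  m≰N = contradiction m²≤2N (ℕ.<⇒≱ (begin-strict
  N ℕ.+ N             ≤⟨ ℕ.+-monoʳ-≤ N (ℕ.m≤m+n N (N ℕ.* N)) ⟩
  N ℕ.+ suc N ℕ.* N   <⟨ ℕ.n<1+n _ ⟩
  suc N ℕ.+ suc N ℕ.* N ≡⟨ ≡.cong (suc N ℕ.+_) (ℕ.*-comm (suc N) N) ⟩
  suc N ℕ.* suc N     ≤⟨ ℕ.*-mono-≤ (ℕ.≰⇒> m≰N) (ℕ.≰⇒> m≰N) ⟩
  m ℕ.* m             ∎))
  where open ℕ.≤-Reasoning

∈-representations : ∀ N {j} → j ℕ.≤ N ℕ.+ N → ∀ ab → ab ∈ representations N j ⇔ norm ab ≡ j
∈-representations N {j} j≤2N (a , b) = mk⇔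
  (norm-representation N j)
  (λ { ≡.refl → ∈-filter⁺ (λ ab → norm ab ℕ.≟ j)
    (∈-cartesianProduct⁺
      (∈-box a (square-bound ∣ a ∣ N (ℕ.m+n≤o⇒m≤o (sq a) j≤2N)))
      (∈-box b (square-bound ∣ b ∣ N (ℕ.m+n≤o⇒n≤o (sq a) j≤2N)))) ≡.refl })

rotate swap : ℤ × ℤ → ℤ × ℤ
rotate (k , l) = k ℤ.+ l , k ℤ.- l
swap (a , b) = b , a

+norm : ∀ a b → + norm (a , b) ≡ a ℤ.* a ℤ.+ b ℤ.* b
+norm a b = ≡.cong₂ ℤ._+_ (+sq a) (+sq b)

norm-rotate : ∀ kl → norm (rotate kl) ≡ 2 ℕ.* norm kl
norm-rotate (k , l) = ℤ.+-injective (begin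
  + norm (k ℤ.+ l , k ℤ.- l)                                     ≡⟨ +norm (k ℤ.+ l) (k ℤ.- l) ⟩
  (k ℤ.+ l) ℤ.* (k ℤ.+ l) ℤ.+ (k ℤ.- l) ℤ.* (k ℤ.- l)             ≡⟨ expand k l ⟩
  (k ℤ.* k ℤ.+ l ℤ.* l) ℤ.+ ((k ℤ.* k ℤ.+ l ℤ.* l) ℤ.+ 0ℤ)       ≡⟨ ≡.cong (λ n → n ℤ.+ (n ℤ.+ 0ℤ)) (+norm k l) ⟨
  + (2 ℕ.* norm (k , l))                                         ∎)
  where
  open ≡.≡-Reasoning
  expand : ∀ k l → (k ℤ.+ l) ℤ.* (k ℤ.+ l) ℤ.+ (k ℤ.- l) ℤ.* (k ℤ.- l)
    ≡ (k ℤ.* k ℤ.+ l ℤ.* l) ℤ.+ ((k ℤ.* k ℤ.+ l ℤ.* l) ℤ.+ 0ℤ)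
  expand = ℤSolver.solve-∀

even-square : ∀ c → (+ 2) ℤ∣.∣ c ℤ.* c → (+ 2) ℤ∣.∣ c
even-square c 2∣c² = ℤ∣.∣ᵤ⇒∣ ([ id , id ]′ (euclidsLemma ∣ c ∣ ∣ c ∣ prime[2]
  (≡.subst (2 ∣_) (ℤ.abs-* c c) (ℤ∣.∣⇒∣ᵤ 2∣c²))))

-- From a² + b² = 2n follows (a + b)² = 2(n + ab), so a + b is even. Its half is k, and l = a - k.
rotate⁻¹ : ∀ {n} ab → norm ab ≡ 2 ℕ.* n → ∃ λ kl → norm kl ≡ n × ab ≡ rotate kl
rotate⁻¹ {n} (a , b) e = unrotate (even-square (a ℤ.+ b) (ℤ∣.divides (+ n ℤ.+ a ℤ.* b) square))
  where
  open ≡.≡-Reasoning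
  square : (a ℤ.+ b) ℤ.* (a ℤ.+ b) ≡ (+ n ℤ.+ a ℤ.* b) ℤ.* + 2
  square = begin
    (a ℤ.+ b) ℤ.* (a ℤ.+ b)                            ≡⟨ expand a b ⟩
    (a ℤ.* a ℤ.+ b ℤ.* b) ℤ.+ a ℤ.* b ℤ.* + 2           ≡⟨ ≡.cong (ℤ._+ a ℤ.* b ℤ.* + 2) (≡.trans (≡.sym (+norm a b)) (≡.cong +_ e)) ⟩
    + n ℤ.+ (+ n ℤ.+ 0ℤ) ℤ.+ a ℤ.* b ℤ.* + 2           ≡⟨ collect (+ n) (a ℤ.* b) ⟩
    (+ n ℤ.+ a ℤ.* b) ℤ.* + 2                          ∎
    where
    expand : ∀ a b → (a ℤ.+ b) ℤ.* (a ℤ.+ b) ≡ (a ℤ.* a ℤ.+ b ℤ.* b) ℤ.+ a ℤ.* b ℤ.* + 2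
    expand = ℤSolver.solve-∀
    collect : ∀ n c → n ℤ.+ (n ℤ.+ 0ℤ) ℤ.+ c ℤ.* + 2 ≡ (n ℤ.+ c) ℤ.* + 2
    collect = ℤSolver.solve-∀
  unrotate : (+ 2) ℤ∣.∣ a ℤ.+ b → ∃ λ kl → norm kl ≡ n × (a , b) ≡ rotate kl
  unrotate (ℤ∣.divides k a+b≡k2) =
    (k , a ℤ.- k) ,
    ℕ.*-cancelˡ-≡ _ _ 2 (≡.trans (≡.sym (norm-rotate (k , a ℤ.- k))) (≡.trans (≡.cong norm (≡.sym ab≡)) e)) ,
    ab≡
    where
    ab≡ : (a , b) ≡ rotate (k , a ℤ.- k)
    ab≡ = ≡.cong₂ _,_ (fst a k) (≡.trans (snd a b) (≡.trans (≡.cong (ℤ._- a) a+b≡k2) (thd k a)))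
      where
      fst : ∀ a k → a ≡ k ℤ.+ (a ℤ.- k)
      fst = ℤSolver.solve-∀
      snd : ∀ a b → b ≡ a ℤ.+ b ℤ.- a
      snd = ℤSolver.solve-∀
      thd : ∀ k a → k ℤ.* + 2 ℤ.- a ≡ k ℤ.- (a ℤ.- k)
      thd = ℤSolver.solve-∀

rotate-injective : ∀ {kl kl′} → rotate kl ≡ rotate kl′ → kl ≡ kl′
rotate-injective {k , l} {k′ , l′} e =
  ≡.cong₂ _,_ (half (≡.trans (sum k l) (≡.trans (≡.cong₂ ℤ._+_ e₁ e₂) (≡.sym (sum k′ l′)))))
              (half (≡.trans (difference k l) (≡.trans (≡.cong₂ ℤ._-_ e₁ e₂) (≡.sym (difference k′ l′)))))
  where
  e₁ = ≡.cong proj₁ e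
  e₂ = ≡.cong proj₂ e
  half : ∀ {i j} → i ℤ.* + 2 ≡ j ℤ.* + 2 → i ≡ j
  half {i} {j} = ℤ.*-cancelʳ-≡ i j (+ 2)
  sum : ∀ k l → k ℤ.* + 2 ≡ (k ℤ.+ l) ℤ.+ (k ℤ.- l)
  sum = ℤSolver.solve-∀
  difference : ∀ k l → l ℤ.* + 2 ≡ (k ℤ.+ l) ℤ.- (k ℤ.- l)
  difference = ℤSolver.solve-∀

-- The bound n ≤ N keeps both n and 2n in the range up to 2N for which the box contains all
-- representations.
∈-rotate-representations : ∀ N {n} → n ℕ.≤ N → ∀ {ab} →
  ab ∈ map rotate (representations N n) ⇔ ab ∈ representations N (2 ℕ.* n)
∈-rotate-representations N {n} n≤N {ab} = mk⇔ forward backward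
  where
  n≤2N : n ℕ.≤ N ℕ.+ N
  n≤2N = ℕ.≤-trans n≤N (ℕ.m≤m+n N N)
  2n≤2N : 2 ℕ.* n ℕ.≤ N ℕ.+ N
  2n≤2N = ℕ.+-mono-≤ n≤N (ℕ.≤-trans (ℕ.≤-reflexive (ℕ.+-identityʳ n)) n≤N)
  forward : ab ∈ map rotate (representations N n) → ab ∈ representations N (2 ℕ.* n)
  forward m = case ∈-map⁻ rotate m of λ { (kl , kl∈ , ≡.refl) →
    from (∈-representations N 2n≤2N (rotate kl))
      (≡.trans (norm-rotate kl) (≡.cong (2 ℕ.*_) (to (∈-representations N n≤2N kl) kl∈))) }
  backward : ab ∈ representations N (2 ℕ.* n) → ab ∈ map rotate (representations N n)
  backward m = case rotate⁻¹ ab (to (∈-representations N 2n≤2N ab) m) of λ { (kl , e , ≡.refl) →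
    ∈-map⁺ rotate (from (∈-representations N n≤2N kl) e) }

∈-swap-representations : ∀ N j {ab} →
  ab ∈ map swap (representations N j) ⇔ ab ∈ representations N j
∈-swap-representations N j {a , b} = mk⇔ forward (λ m → ∈-map⁺ swap (swapped m))
  where
  norm≟ = λ ab → norm ab ℕ.≟ j
  swapped : ∀ {a b} → (a , b) ∈ representations N j → (b , a) ∈ representations N j
  swapped {a} {b} m = ∈-filter⁺ norm≟
    (∈-cartesianProduct⁺ (proj₂ (∈-cartesianProduct⁻ (box N) (box N) ab∈)) (proj₁ (∈-cartesianProduct⁻ (box N) (box N) ab∈)))
    (≡.trans (ℕ.+-comm (sq b) (sq a)) norm≡)
    where
    ab∈ = proj₁ (∈-filter⁻ norm≟ {xs = pairs N} m)
    norm≡ = norm-representation N j m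
  forward : (a , b) ∈ map swap (representations N j) → (a , b) ∈ representations N j
  forward m = case ∈-map⁻ swap m of λ { ((b , a) , ba∈ , ≡.refl) → swapped ba∈ }

-- Theta series

-- This is (d - 1)² ≥ 0, freed of subtraction.
double≤square+1 : ∀ d → d ℕ.+ d ℕ.≤ suc (d ℕ.* d)
double≤square+1 zero    = ℕ.z≤n
double≤square+1 (suc m) = ≡.subst (suc m ℕ.+ suc m ℕ.≤_) (expand m) (ℕ.m≤m+n _ (m ℕ.* m))
  where
  expand : ∀ m → (suc m ℕ.+ suc m) ℕ.+ m ℕ.* m ≡ suc (suc m ℕ.* suc m)
  expand = ℕSolver.solve-∀

-- Here d stands for the distance of an index from the centre, and d + m for N: the exponent d² +
-- 2(N - d + 1) reaches the modulus q^(2N+1).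
truncation-bound : ∀ d m → suc ((d ℕ.+ m) ℕ.+ (d ℕ.+ m)) ℕ.≤ d ℕ.* d ℕ.+ 2 ℕ.* suc m
truncation-bound d m = begin
  suc ((d ℕ.+ m) ℕ.+ (d ℕ.+ m))        ≡⟨ collect d m ⟩
  (d ℕ.+ d) ℕ.+ suc (m ℕ.+ m)          ≤⟨ ℕ.+-monoˡ-≤ (suc (m ℕ.+ m)) (double≤square+1 d) ⟩
  suc (d ℕ.* d) ℕ.+ suc (m ℕ.+ m)      ≡⟨ expand (d ℕ.* d) m ⟩
  d ℕ.* d ℕ.+ 2 ℕ.* suc m              ∎
  where
  open ℕ.≤-Reasoning
  collect : ∀ d m → suc ((d ℕ.+ m) ℕ.+ (d ℕ.+ m)) ≡ (d ℕ.+ d) ℕ.+ suc (m ℕ.+ m)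
  collect = ℕSolver.solve-∀
  expand : ∀ s m → suc s ℕ.+ suc (m ℕ.+ m) ≡ s ℕ.+ 2 ℕ.* suc m
  expand = ℕSolver.solve-∀

-- The solver runs once over an abstract ring, and only the resulting identities are instantiated at
-- power series.
module Rearrangements {c ℓ} (R : CommutativeRing c ℓ) where
  open CommutativeRing R
  open SemiringSolver commutativeSemiring using (solve; _:=_; _:*_)

  xy∙z≈x∙zy : ∀ x y z → (x * y) * z ≈ x * (z * y)
  xy∙z≈x∙zy = solve 3 (λ x y z → (x :* y) :* z := x :* (z :* y)) refl

  xy∙z≈zx∙y : ∀ x y z → (x * y) * z ≈ (z * x) * y
  xy∙z≈zx∙y = solve 3 (λ x y z → (x :* y) :* z := (z :* x) :* y) refl

  x∙yyz≈yy∙zx : ∀ x y z → x * (y * (y * z)) ≈ y * (y * (z * x))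
  x∙yyz≈yy∙zx = solve 3 (λ x y z → x :* (y :* (y :* z)) := y :* (y :* (z :* x))) refl

  xy∙xy≈xx∙yy : ∀ x y → (x * y) * (x * y) ≈ (x * x) * (y * y)
  xy∙xy≈xx∙yy = solve 2 (λ x y → (x :* y) :* (x :* y) := (x :* x) :* (y :* y)) refl

module EvenPart {c ℓ} (S : CommutativeRing c ℓ) where
  open PowerSeries S
  open FiniteTripleProduct seriesRing q
  private
    module S = CommutativeRing S
    module P = CommutativeRing seriesRing
    module ΣS = Sums S
    module ΣP = Sums seriesRing
    module T K = CommutativeRing (truncated K)
    module ΣT K = Sums (truncated K)
  open import Algebra.Properties.Ring S.ring using (-‿involutive)
  open import Algebra.Properties.Semiring.Exp P.semiring using (_^_; ^-homo-*)

  -- The Pascal rule changes the coefficient only by a multiple of q^(2(b+1)), so Gaussian binomials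
  -- stabilise as an index grows.
  gauss-sucʳ : ∀ a b → gauss a (suc b) ≋[ 2 ℕ.* suc b ] gauss a b
  gauss-sucʳ zero    b i _   = S.refl
  gauss-sucʳ (suc a) b i i<K =
    S.trans (S.+-congˡ (q^-⊠-small (2 ℕ.* suc b) (gauss a (suc b)) i i<K)) (S.+-identityʳ _)

  gauss-sucˡ : ∀ a b → gauss (suc a) b ≋[ 2 ℕ.* suc a ] gauss a b
  gauss-sucˡ a zero    i _   = S.sym (gauss-0ʳ a i)
  gauss-sucˡ a (suc b) i i<K = S.trans (gauss-pascal a b i)
    (S.trans (S.+-congˡ (q^-⊠-small (2 ℕ.* suc a) (gauss (suc a) b) i i<K)) (S.+-identityʳ _))

  gauss-+ʳ : ∀ a d b → gauss a (d ℕ.+ b) ≋[ 2 ℕ.* suc b ] gauss a b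
  gauss-+ʳ a zero    b i _   = S.refl
  gauss-+ʳ a (suc d) b i i<K = S.trans
    (gauss-sucʳ a (d ℕ.+ b) i (ℕ.<-≤-trans i<K (ℕ.*-monoʳ-≤ 2 (ℕ.s≤s (ℕ.m≤n+m b d)))))
    (gauss-+ʳ a d b i i<K)

  gauss-+ˡ : ∀ d a b → gauss (d ℕ.+ a) b ≋[ 2 ℕ.* suc a ] gauss a b
  gauss-+ˡ zero    a b i _   = S.refl
  gauss-+ˡ (suc d) a b i i<K = S.trans
    (gauss-sucˡ (d ℕ.+ a) b i (ℕ.<-≤-trans i<K (ℕ.*-monoʳ-≤ 2 (ℕ.s≤s (ℕ.m≤n+m a d)))))
    (gauss-+ˡ d a b i i<K)

  -- With k = a − N, gauss a b differs from gauss N N by a multiple of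
  -- q^{2(N − |k| + 1)}, which the factor q^{k²} pushes beyond q^{2N}:
  -- k² + 2(N − |k| + 1) = (|k| − 1)² + 2N + 1.
  gauss-central : ∀ N a b → a ℕ.+ b ≡ N ℕ.+ N →
    q ^ sq (+ a ℤ.- + N) ⊠ gauss a b ≋[ suc (N ℕ.+ N) ] q ^ sq (+ a ℤ.- + N) ⊠ gauss N N
  gauss-central N a b a+b≡2N with ℕ.≤-total a N
  ... | inj₁ a≤N = below (N ℕ.∸ a) (≡.sym (ℕ.m∸n+n≡m a≤N))
    where
    below : ∀ d → N ≡ d ℕ.+ a →
      q ^ sq (+ a ℤ.- + N) ⊠ gauss a b ≋[ suc (N ℕ.+ N) ] q ^ sq (+ a ℤ.- + N) ⊠ gauss N N
    below d ≡.refl = ≋[]-mono bound (q^-⊠-cong (sq (+ a ℤ.- + N)) near)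
      where
      b≡ : b ≡ d ℕ.+ N
      b≡ = ℕ.+-cancelˡ-≡ a _ _ (≡.trans a+b≡2N (rearrange d a))
        where
        rearrange : ∀ d a → (d ℕ.+ a) ℕ.+ (d ℕ.+ a) ≡ a ℕ.+ (d ℕ.+ (d ℕ.+ a))
        rearrange = ℕSolver.solve-∀
      sq≡ : sq (+ a ℤ.- + N) ≡ d ℕ.* d
      sq≡ = ≡.trans (≡.cong sq (cancel (+ d) (+ a))) (≡.cong (λ m → m ℕ.* m) (ℤ.∣-i∣≡∣i∣ (+ d)))
        where
        cancel : ∀ d a → a ℤ.- (d ℤ.+ a) ≡ ℤ.- d
        cancel = ℤSolver.solve-∀
      bound : suc (N ℕ.+ N) ℕ.≤ sq (+ a ℤ.- + N) ℕ.+ 2 ℕ.* suc a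
      bound = ≡.subst (λ s → suc (N ℕ.+ N) ℕ.≤ s ℕ.+ 2 ℕ.* suc a) (≡.sym sq≡) (truncation-bound d a)
      -- The smaller index a limits the precision: replacing b by N is correct to order 2(N + 1),
      -- raising a to N only to order 2(a + 1).
      near : gauss a b ≋[ 2 ℕ.* suc a ] gauss N N
      near i i<K = S.trans
        (≡.subst (λ b → gauss a b i S.≈ gauss a N i) (≡.sym b≡)
          (gauss-+ʳ a d N i (ℕ.<-≤-trans i<K (ℕ.*-monoʳ-≤ 2 (ℕ.s≤s a≤N)))))
        (S.sym (gauss-+ˡ d a N i i<K))
  ... | inj₂ N≤a = above (a ℕ.∸ N) (≡.sym (ℕ.m∸n+n≡m N≤a))
    where
    above : ∀ d → a ≡ d ℕ.+ N →
      q ^ sq (+ a ℤ.- + N) ⊠ gauss a b ≋[ suc (N ℕ.+ N) ] q ^ sq (+ a ℤ.- + N) ⊠ gauss N N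
    above d ≡.refl = ≋[]-mono bound (q^-⊠-cong (sq (+ a ℤ.- + N)) near)
      where
      N≡ : N ≡ d ℕ.+ b
      N≡ = ℕ.+-cancelʳ-≡ N _ _ (≡.trans (≡.sym a+b≡2N) (rearrange d N b))
        where
        rearrange : ∀ d N b → (d ℕ.+ N) ℕ.+ b ≡ (d ℕ.+ b) ℕ.+ N
        rearrange = ℕSolver.solve-∀
      sq≡ : sq (+ a ℤ.- + N) ≡ d ℕ.* d
      sq≡ = ≡.cong sq (cancel (+ d) (+ N))
        where
        cancel : ∀ d N → d ℤ.+ N ℤ.- N ≡ d
        cancel = ℤSolver.solve-∀
      bound : suc (N ℕ.+ N) ℕ.≤ sq (+ a ℤ.- + N) ℕ.+ 2 ℕ.* suc b
      bound = ≡.subst₂ (λ s M → suc (M ℕ.+ M) ℕ.≤ s ℕ.+ 2 ℕ.* suc b) (≡.sym sq≡) (≡.sym N≡) (truncation-bound d b)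
      near : gauss a b ≋[ 2 ℕ.* suc b ] gauss N N
      near i i<K = S.trans
        (gauss-+ˡ d N b i (ℕ.<-≤-trans i<K (ℕ.*-monoʳ-≤ 2 (ℕ.s≤s (≡.subst (b ℕ.≤_) (≡.sym N≡) (ℕ.m≤n+m b d))))))
        (S.sym (≡.subst (λ M → gauss N M i S.≈ gauss N b i) (≡.sym N≡) (gauss-+ʳ N d b i i<K)))

  -- The coefficients are themselves series, so that theta series can be nested as in
  -- `theta-shifts`.
  theta : ℕ → (ℤ → Coeffs) → Coeffs
  theta N v = ΣP.Σ[ box N ] (λ k → q ^ sq k ⊠ v k)

  diag-box : ∀ N (f : ℤ → Coeffs) → ΣP.diag (N ℕ.+ N) (λ a _ → f (+ a ℤ.- + N)) ≋ ΣP.Σ[ box N ] f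
  diag-box N f = P.trans (ΣP.diag-Σ (N ℕ.+ N) _)
    (P.reflexive (≡.sym (ΣP.Σ-map (λ a → + a ℤ.- + N) (upTo (suc (N ℕ.+ N))) f)))

  -- The two rings share their addition, but `diag` at a variable length does not reduce, so the
  -- agreement takes an induction.
  diag-truncated : ∀ K n f → ΣT.diag K n f ≡ ΣP.diag n f
  diag-truncated K zero    f = ≡.refl
  diag-truncated K (suc n) f = ≡.cong (f 0 (suc n) ⊞_) (diag-truncated K n _)

  -- By `gauss-central` every Gaussian binomial in the sum may be replaced by the central one, which
  -- then factors out.
  rothe-theta : ∀ N v → rothe N N v ≋[ suc (N ℕ.+ N) ] gauss N N ⊠ theta N v
  rothe-theta N v = begin
    rothe N N v                                      ≡⟨ diag-truncated K (N ℕ.+ N) _ ⟨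
    ΣT.diag K (N ℕ.+ N) (λ a b → gauss a b ⊠ term (+ a ℤ.- + N)) ≈⟨ ΣT.diag-cong K (N ℕ.+ N) central ⟩
    ΣT.diag K (N ℕ.+ N) (λ a b → gauss N N ⊠ term (+ a ℤ.- + N)) ≈⟨ ΣT.diag-*ˡ K (N ℕ.+ N) _ _ ⟩
    gauss N N ⊠ ΣT.diag K (N ℕ.+ N) (λ a b → term (+ a ℤ.- + N)) ≡⟨ ≡.cong (gauss N N ⊠_) (diag-truncated K (N ℕ.+ N) _) ⟩
    gauss N N ⊠ ΣP.diag (N ℕ.+ N) (λ a b → term (+ a ℤ.- + N)) ≈⟨ ≋⇒≋[] K (P.*-congˡ (diag-box N term)) ⟩
    gauss N N ⊠ theta N v                            ∎
    where
    K = suc (N ℕ.+ N)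
    open import Relation.Binary.Reasoning.Setoid (T.setoid K)
    term : ℤ → Coeffs
    term k = q ^ sq k ⊠ v k
    regroup : ∀ g x y → g ⊠ (x ⊠ y) ≋[ K ] (x ⊠ g) ⊠ y
    regroup g x y = ≋⇒≋[] K (P.trans (P.sym (P.*-assoc g x y)) (P.*-congʳ (P.*-comm g x)))
    central : ∀ a b → a ℕ.+ b ≡ N ℕ.+ N →
      gauss a b ⊠ term (+ a ℤ.- + N) ≋[ K ] gauss N N ⊠ term (+ a ℤ.- + N)
    central a b e = T.trans K (regroup (gauss a b) (q ^ sq k) (v k))
      (T.trans K (T.*-congʳ K {x = v k} (gauss-central N a b e)) (T.sym K (regroup (gauss N N) (q ^ sq k) (v k))))
      where k = + a ℤ.- + N

  -- The finite form of the Jacobi triple product, with the free value at 0 as a factor.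
  gauss-theta : ∀ N {Y v} → Solves Y v → gauss N N ⊠ theta N v ≋[ suc (N ℕ.+ N) ] oddProduct N Y ⊠ v 0ℤ
  gauss-theta N {Y} {v} s = T.trans _ (T.sym _ (rothe-theta N v)) (≋⇒≋[] _ (oddProduct-rothe N s))

  pairSum : ℕ → (ℤ × ℤ → S.Carrier) → Coeffs
  pairSum N h = ΣP.Σ[ pairs N ] (λ ab → q ^ norm ab ⊠ const (h ab))

  pairSum-coeff : ∀ N h j → pairSum N h j S.≈ ΣS.Σ[ representations N j ] h
  pairSum-coeff N h j = begin
    pairSum N h j ≈⟨ Σ-coeff (pairs N) _ j ⟩
    ΣS.Σ[ pairs N ] (λ ab → (q ^ norm ab ⊠ const (h ab)) j)
      ≈⟨ ΣS.Σ-cong (pairs N) (λ ab → monomial (norm ab) (h ab) j) ⟩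
    ΣS.Σ[ pairs N ] (λ ab → if does (norm ab ℕ.≟ j) then h ab else S.0#)
      ≈⟨ ΣS.Σ-filter (λ ab → norm ab ℕ.≟ j) (pairs N) h ⟨
    ΣS.Σ[ representations N j ] h ∎
    where open import Relation.Binary.Reasoning.Setoid S.setoid

  theta₁ : ℕ → Coeffs
  theta₁ N = theta N (λ _ → P.1#)

  theta-theta₁ : ∀ N v → theta N (const ∘ v) ⊠ theta₁ N ≋ pairSum N (v ∘ proj₁)
  theta-theta₁ N v = P.trans (ΣP.Σ-*-Σ (box N) (box N) _ _) (ΣP.Σ-cong (pairs N) step)
    where
    step : ∀ ((a , b) : ℤ × ℤ) → (q ^ sq a ⊠ const (v a)) ⊠ (q ^ sq b ⊠ P.1#) ≋ q ^ norm (a , b) ⊠ const (v a)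
    step (a , b) = begin
      (q ^ sq a ⊠ const (v a)) ⊠ (q ^ sq b ⊠ P.1#) ≈⟨ P.*-congˡ (P.*-identityʳ (q ^ sq b)) ⟩
      (q ^ sq a ⊠ const (v a)) ⊠ q ^ sq b ≈⟨ P.*-assoc (q ^ sq a) (const (v a)) (q ^ sq b) ⟩
      q ^ sq a ⊠ (const (v a) ⊠ q ^ sq b) ≈⟨ P.*-congˡ (P.*-comm (const (v a)) (q ^ sq b)) ⟩
      q ^ sq a ⊠ (q ^ sq b ⊠ const (v a)) ≈⟨ P.*-assoc (q ^ sq a) (q ^ sq b) (const (v a)) ⟨
      q ^ sq a ⊠ q ^ sq b ⊠ const (v a) ≈⟨ P.*-congʳ (^-homo-* q (sq a) (sq b)) ⟨
      q ^ norm (a , b) ⊠ const (v a) ∎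
      where open import Relation.Binary.Reasoning.Setoid P.setoid

  theta-shifts : ∀ N v →
    theta N (λ k → theta N (λ l → const (v (k ℤ.+ l)))) ≋ pairSum N (v ∘ proj₁ ∘ rotate)
  theta-shifts N v = P.trans (ΣP.Σ-cong (box N) inner) (P.sym (ΣP.Σ-× (box N) (box N) _))
    where
    inner : ∀ k → q ^ sq k ⊠ theta N (λ l → const (v (k ℤ.+ l)))
                ≋ ΣP.Σ[ box N ] (λ l → q ^ norm (k , l) ⊠ const (v (k ℤ.+ l)))
    inner k = P.trans (P.sym (ΣP.Σ-*ˡ (q ^ sq k) (box N) (λ l → q ^ sq l ⊠ const (v (k ℤ.+ l)))))
      (ΣP.Σ-cong (box N) (λ l → P.trans (P.sym (P.*-assoc (q ^ sq k) (q ^ sq l) (const (v (k ℤ.+ l)))))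
        (P.*-congʳ (P.sym (^-homo-* q (sq k) (sq l))))))

  -- Even parts of products of theta series

  even : Coeffs → Coeffs
  even F n = F (2 ℕ.* n)

  even-truncated : ∀ N {F G} → F ≋[ suc (N ℕ.+ N) ] G → even F ≋[ suc N ] even G
  even-truncated N e i i≤N = e (2 ℕ.* i) (ℕ.s≤s (ℕ.+-mono-≤ (ℕ.s≤s⁻¹ i≤N)
    (ℕ.≤-trans (ℕ.≤-reflexive (ℕ.+-identityʳ i)) (ℕ.s≤s⁻¹ i≤N))))

  even-pairSum : ∀ N v → even (pairSum N (v ∘ proj₁)) ≋[ suc N ] pairSum N (v ∘ proj₁ ∘ rotate)
  even-pairSum N v n n≤N = begin
    pairSum N (v ∘ proj₁) (2 ℕ.* n)                              ≈⟨ pairSum-coeff N (v ∘ proj₁) (2 ℕ.* n) ⟩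
    ΣS.Σ[ representations N (2 ℕ.* n) ] (v ∘ proj₁)
      ≈⟨ ΣS.Σ-unique (v ∘ proj₁) (Unique.map⁺ rotate-injective (representations-unique N n))
           (representations-unique N (2 ℕ.* n)) (λ {ab} → ∈-rotate-representations N (ℕ.s≤s⁻¹ n≤N)) ⟨
    ΣS.Σ[ map rotate (representations N n) ] (v ∘ proj₁)         ≡⟨ ΣS.Σ-map rotate (representations N n) (v ∘ proj₁) ⟩
    ΣS.Σ[ representations N n ] (v ∘ proj₁ ∘ rotate)             ≈⟨ pairSum-coeff N (v ∘ proj₁ ∘ rotate) n ⟨
    pairSum N (v ∘ proj₁ ∘ rotate) n                             ∎
    where open import Relation.Binary.Reasoning.Setoid S.setoid

  even-theta-theta₁ : ∀ N v →
    even (theta N (const ∘ v) ⊠ theta₁ N) ≋[ suc N ] theta N (λ k → theta N (λ l → const (v (k ℤ.+ l))))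
  even-theta-theta₁ N v i i≤N = S.trans (theta-theta₁ N v (2 ℕ.* i))
    (S.trans (even-pairSum N v i i≤N) (S.sym (theta-shifts N v i)))

  theta-truncated-cong : ∀ N K v w → (∀ k → v k ≋[ K ] w k) → theta N v ≋[ K ] theta N w
  theta-truncated-cong N K v w e i i<K = S.trans (Σ-coeff (box N) _ i)
    (S.trans (ΣS.Σ-cong (box N) (λ k → T.*-congˡ K {x = q ^ sq k} (e k) i i<K)) (S.sym (Σ-coeff (box N) _ i)))

  theta-*ˡ : ∀ N F v → theta N (λ k → F ⊠ v k) ≋ F ⊠ theta N v
  theta-*ˡ N F v = P.trans (ΣP.Σ-cong (box N) (λ k → swap-left (q ^ sq k) F (v k))) (ΣP.Σ-*ˡ F (box N) _)
    where
    swap-left : ∀ x y z → x ⊠ (y ⊠ z) ≋ y ⊠ (x ⊠ z)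
    swap-left x y z = P.trans (P.sym (P.*-assoc x y z)) (P.trans (P.*-congʳ (P.*-comm x y)) (P.*-assoc y x z))

  -- The parallelogram rotation (a , b) = (k + l , k − l) turns the even part of
  -- θ(v) θ(1) into a double sum whose inner sums are shifted theta series.
  even-theta-square : ∀ N {Y v} → Solves Y (const ∘ v) → v 0ℤ S.≈ S.1# →
    gauss N N ⊠ (gauss N N ⊠ even (theta N (const ∘ v) ⊠ theta₁ N)) ≋[ suc N ] oddProduct N Y ⊠ oddProduct N Y
  even-theta-square N {Y} {v} s v₀ = begin
    g ⊠ (g ⊠ even (theta N (const ∘ v) ⊠ theta₁ N))
      ≈⟨ T.*-congˡ K {x = g} (T.*-congˡ K {x = g} (even-theta-theta₁ N v)) ⟩
    g ⊠ (g ⊠ theta N (λ k → theta N (λ l → const (v (k ℤ.+ l)))))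
      ≈⟨ T.*-congˡ K {x = g} (≋⇒≋[] K (P.sym (theta-*ˡ N g _))) ⟩
    g ⊠ theta N (λ k → g ⊠ theta N (λ l → const (v (k ℤ.+ l))))
      -- The inner sum is the theta series of the solution l ↦ v (k + l), whose value at 0 is v k,
      -- so `gauss-theta` evaluates it.
      ≈⟨ T.*-congˡ K {x = g} (theta-truncated-cong N K _ _ shifted) ⟩
    g ⊠ theta N (λ k → G ⊠ const (v k))
      ≈⟨ T.*-congˡ K {x = g} (≋⇒≋[] K (theta-*ˡ N G (const ∘ v))) ⟩
    g ⊠ (G ⊠ theta N (const ∘ v))
      ≈⟨ ≋⇒≋[] K (P.trans (P.sym (P.*-assoc g G _)) (P.trans (P.*-congʳ (P.*-comm g G)) (P.*-assoc G g _))) ⟩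
    G ⊠ (g ⊠ theta N (const ∘ v))
      ≈⟨ T.*-congˡ K {x = G} (≋[]-mono K≤ (gauss-theta N s)) ⟩
    G ⊠ (G ⊠ const (v 0ℤ))
      ≈⟨ ≋⇒≋[] K (P.*-congˡ (P.trans (P.*-congˡ (const-cong v₀)) (P.*-identityʳ G))) ⟩
    G ⊠ G ∎
    where
    K = suc N
    g = gauss N N
    G = oddProduct N Y
    K≤ : K ℕ.≤ suc (N ℕ.+ N)
    K≤ = ℕ.s≤s (ℕ.m≤m+n N N)
    open import Relation.Binary.Reasoning.Setoid (T.setoid K)
    shifted : ∀ k → g ⊠ theta N (λ l → const (v (k ℤ.+ l))) ≋[ K ] G ⊠ const (v k)
    shifted k = ≋[]-mono K≤ (≡.subst (λ k′ → g ⊠ theta N (λ l → const (v (k ℤ.+ l))) ≋[ suc (N ℕ.+ N) ] G ⊠ const (v k′))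
      (ℤ.+-identityʳ k) (gauss-theta N (Solves-shift k s)))

  -- The alternating theta series

  sign : ℕ → S.Carrier
  sign zero    = S.1#
  sign (suc n) = S.- sign n

  sign-double : ∀ m x → sign (m ℕ.+ (m ℕ.+ x)) S.≈ sign x
  sign-double zero    x = S.refl
  sign-double (suc m) x = begin
    S.- sign (m ℕ.+ suc (m ℕ.+ x)) ≡⟨ ≡.cong (λ n → S.- sign n) (ℕ.+-suc m (m ℕ.+ x)) ⟩
    S.- S.- sign (m ℕ.+ (m ℕ.+ x)) ≈⟨ -‿involutive _ ⟩
    sign (m ℕ.+ (m ℕ.+ x))         ≈⟨ sign-double m x ⟩
    sign x                         ∎
    where open import Relation.Binary.Reasoning.Setoid S.setoid

  sign-square : ∀ m → sign (m ℕ.* m) S.≈ sign m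
  sign-square zero    = S.refl
  sign-square (suc m) = S.-‿cong (begin
    sign (m ℕ.+ m ℕ.* suc m)     ≡⟨ ≡.cong (λ n → sign (m ℕ.+ n)) (ℕ.*-suc m m) ⟩
    sign (m ℕ.+ (m ℕ.+ m ℕ.* m)) ≈⟨ sign-double m (m ℕ.* m) ⟩
    sign (m ℕ.* m)               ≈⟨ sign-square m ⟩
    sign m                       ∎)
    where open import Relation.Binary.Reasoning.Setoid S.setoid

  -- Moving a unit from i to j negates both signs, which reduces the claim to i = 0.
  sign-odd : ∀ i j n → i ℕ.+ j ≡ suc (2 ℕ.* n) → sign j S.≈ S.- sign i
  sign-odd zero    _ n ≡.refl = S.-‿cong (sign-double n 0)
  sign-odd (suc i) j n e      = S.trans (S.sym (-‿involutive (sign j)))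
    (S.-‿cong (sign-odd i (suc j) n (≡.trans (ℕ.+-suc i j) e)))

  alternating : ℤ → S.Carrier
  alternating k = sign ∣ k ∣

  alternating-suc : ∀ k → alternating (ℤ.suc k) S.≈ S.- alternating k
  alternating-suc (+ n)          = S.refl
  alternating-suc -[1+ zero ]    = S.sym (-‿involutive _)
  alternating-suc -[1+ suc n ]   = S.sym (-‿involutive _)

  alternating-pred : ∀ k → alternating (ℤ.pred k) S.≈ S.- alternating k
  alternating-pred k = begin
    alternating (ℤ.pred k)               ≈⟨ -‿involutive _ ⟨
    S.- S.- alternating (ℤ.pred k)       ≈⟨ S.-‿cong (alternating-suc (ℤ.pred k)) ⟨
    S.- alternating (ℤ.suc (ℤ.pred k))   ≡⟨ ≡.cong (λ i → S.- alternating i) (ℤ.suc-pred k) ⟩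
    S.- alternating k                    ∎
    where open import Relation.Binary.Reasoning.Setoid S.setoid

  -2P : Coeffs
  -2P = ⊟ (P.1# ⊞ P.1#)

  alternating-solves : Solves -2P (const ∘ alternating)
  alternating-solves k = begin
    const (alternating (ℤ.suc k)) ⊞ const (alternating (ℤ.pred k))
      ≈⟨ P.+-cong (negated (alternating-suc k)) (negated (alternating-pred k)) ⟩
    ⊟ ε ⊞ ⊟ ε
      ≈⟨ P.+-cong (P.-‿cong (P.*-identityˡ ε)) (P.-‿cong (P.*-identityˡ ε)) ⟨
    ⊟ (P.1# ⊠ ε) ⊞ ⊟ (P.1# ⊠ ε)
      ≈⟨ -‿+-comm (P.1# ⊠ ε) (P.1# ⊠ ε) ⟩
    ⊟ (P.1# ⊠ ε ⊞ P.1# ⊠ ε)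
      ≈⟨ P.-‿cong (P.distribʳ ε P.1# P.1#) ⟨
    ⊟ ((P.1# ⊞ P.1#) ⊠ ε)
      ≈⟨ -‿distribˡ-* (P.1# ⊞ P.1#) ε ⟩
    -2P ⊠ ε ∎
    where
    ε = const (alternating k)
    open import Relation.Binary.Reasoning.Setoid P.setoid
    open import Algebra.Properties.Ring P.ring using (-‿distribˡ-*; -‿+-comm)
    negated : ∀ {s} → s S.≈ S.- alternating k → const s ≋ ⊟ ε
    negated e = P.trans (const-cong e) (const-neg (alternating k))

  -- If a² + b² is odd, exactly one of a and b is odd. Swapping them permutes the representations
  -- and negates every summand, so the coefficient equals its own negative.
  theta-alternating-odd : (∀ s → s S.≈ S.- s → s S.≈ S.0#) → ∀ N n →
    (theta N (const ∘ alternating) ⊠ theta₁ N) (suc (2 ℕ.* n)) S.≈ S.0#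
  theta-alternating-odd torsion-free N n = S.trans (theta-theta₁ N alternating j)
    (S.trans (pairSum-coeff N (alternating ∘ proj₁) j) (torsion-free _ (begin
      ΣS.Σ[ representations N j ] (alternating ∘ proj₁)
        ≈⟨ ΣS.Σ-unique (alternating ∘ proj₁) (Unique.map⁺ (λ { ≡.refl → ≡.refl }) (representations-unique N j))
             (representations-unique N j) (λ {ab} → ∈-swap-representations N j) ⟨
      ΣS.Σ[ map swap (representations N j) ] (alternating ∘ proj₁)
        ≡⟨ ΣS.Σ-map swap (representations N j) (alternating ∘ proj₁) ⟩
      ΣS.Σ[ representations N j ] (alternating ∘ proj₂)
        ≈⟨ ΣS.Σ-cong-∈ (representations N j) (λ {ab} ab∈ → opposite ab (norm-representation N j ab∈)) ⟩
      ΣS.Σ[ representations N j ] (λ ab → S.- alternating (proj₁ ab))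
        ≈⟨ ΣS.Σ-neg (representations N j) (alternating ∘ proj₁) ⟩
      S.- ΣS.Σ[ representations N j ] (alternating ∘ proj₁) ∎)))
    where
    open import Relation.Binary.Reasoning.Setoid S.setoid
    j = suc (2 ℕ.* n)
    opposite : ∀ ((a , b) : ℤ × ℤ) → norm (a , b) ≡ j → alternating b S.≈ S.- alternating a
    opposite (a , b) e = S.trans (S.sym (sign-square ∣ b ∣))
      (S.trans (sign-odd (sq a) (sq b) n e) (S.-‿cong (sign-square ∣ a ∣)))

  -- The recursion strips two coefficients of H at a time, and the one of odd index contributes
  -- nothing.
  even-⊠ : ∀ H F → (∀ n → H (suc (2 ℕ.* n)) S.≈ S.0#) → even (H ⊠ F) ≋ even H ⊠ even F
  even-⊠ H F odd zero    = S.refl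
  even-⊠ H F odd (suc n) = begin
    (H ⊠ F) (2 ℕ.* suc n)                               ≡⟨ ≡.cong (H ⊠ F) (ℕ.*-suc 2 n) ⟩
    H 0 S.* F (2 ℕ.+ 2 ℕ.* n) S.+ (H 1 S.* F (suc (2 ℕ.* n)) S.+ (H″ ⊠ F) (2 ℕ.* n))
      ≈⟨ S.+-cong (S.*-congˡ (S.reflexive (≡.cong F (≡.sym (ℕ.*-suc 2 n)))))
                  (S.trans (S.+-congʳ (S.trans (S.*-congʳ (odd 0)) (S.zeroˡ _))) (S.+-identityˡ _)) ⟩
    H 0 S.* F (2 ℕ.* suc n) S.+ (H″ ⊠ F) (2 ℕ.* n)
      ≈⟨ S.+-congˡ (even-⊠ H″ F (λ m → S.trans (S.reflexive (≡.cong (H ∘ suc) (≡.sym (ℕ.*-suc 2 m)))) (odd (suc m))) n) ⟩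
    H 0 S.* F (2 ℕ.* suc n) S.+ (even H″ ⊠ even F) n
      ≈⟨ S.+-congˡ (P.*-congʳ {x = even F} (λ m → S.reflexive (≡.cong H (≡.sym (ℕ.*-suc 2 m)))) n) ⟩
    (even H ⊠ even F) (suc n)                           ∎
    where
    open import Relation.Binary.Reasoning.Setoid S.setoid
    H″ : Coeffs
    H″ m = H (2 ℕ.+ m)

  -- The even part of a quotient of theta series

  gauss-constant : ∀ a b → gauss a b 0 S.≈ S.1#
  gauss-constant zero    b       = S.refl
  gauss-constant (suc a) zero    = S.refl
  gauss-constant (suc a) (suc b) = S.trans (gauss-sucʳ (suc a) b 0 ℕ.z<s) (gauss-constant (suc a) b)

  oddProduct-constant : ∀ N Y → oddProduct N Y 0 S.≈ S.1#
  oddProduct-constant zero    Y = S.refl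
  oddProduct-constant (suc N) Y = S.trans (S.*-cong (oddProduct-constant N Y) factor) (S.*-identityˡ _)
    where
    q₀ : (q ^ suc (2 ℕ.* N)) 0 S.≈ S.0#
    q₀ = S.zeroˡ _
    factor : S.1# S.+ Y 0 S.* (q ^ suc (2 ℕ.* N)) 0 S.+ (q ^ suc (2 ℕ.* N)) 0 S.* (q ^ suc (2 ℕ.* N)) 0 S.≈ S.1#
    factor = S.trans (S.+-cong (S.trans (S.+-congˡ (S.trans (S.*-congˡ q₀) (S.zeroʳ _))) (S.+-identityʳ _))
                               (S.trans (S.*-congʳ q₀) (S.zeroˡ _))) (S.+-identityʳ _)

  even-theta-quotient : (∀ s → s S.≈ S.- s → s S.≈ S.0#) →
    ∀ {D Y u} → Solves Y (const ∘ u) → u 0ℤ S.≈ S.1# →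
    (∀ N → D ⊠ oddProduct N -2P ≋[ suc (N ℕ.+ N) ] oddProduct N Y) →
    even D ≋ D ⊠ D
  even-theta-quotient torsion-free {D} {Y} {u} solves u₀ quotient N =
    -- The square of G₋ has constant term 1 and is cancelled modulo q^(N+1); the coefficient of
    -- index N is the last one still covered.
    ⊠-cancelʳ K (even D) (D ⊠ D) (S.trans (S.*-cong (oddProduct-constant N -2P) (oddProduct-constant N -2P)) (S.*-identityˡ _))
      squares N ℕ.≤-refl
    where
    K  = suc N
    K₂ = suc (N ℕ.+ N)
    g  = gauss N N
    G  = oddProduct N Y
    G₋ = oddProduct N -2P
    θ  = theta N (const ∘ u)
    θ₋ = theta N (const ∘ alternating)
    θ₁ = theta₁ N
    module R = Rearrangements seriesRing

    theta-quotient : D ⊠ θ₋ ≋[ K₂ ] θ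
    theta-quotient = ⊠-cancelʳ K₂ (D ⊠ θ₋) θ (gauss-constant N N) (begin
      (D ⊠ θ₋) ⊠ g            ≈⟨ ≋⇒≋[] K₂ (R.xy∙z≈x∙zy D θ₋ g) ⟩
      D ⊠ (g ⊠ θ₋)            ≈⟨ T.*-congˡ K₂ {x = D} (gauss-theta N alternating-solves) ⟩
      D ⊠ (G₋ ⊠ P.1#)         ≈⟨ ≋⇒≋[] K₂ (P.*-congˡ (P.*-identityʳ G₋)) ⟩
      D ⊠ G₋                  ≈⟨ quotient N ⟩
      G                       ≈⟨ ≋⇒≋[] K₂ (P.trans (P.*-congˡ (const-cong u₀)) (P.*-identityʳ G)) ⟨
      G ⊠ const (u 0ℤ)        ≈⟨ gauss-theta N solves ⟨
      g ⊠ θ                   ≈⟨ ≋⇒≋[] K₂ (P.*-comm g θ) ⟩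
      θ ⊠ g                   ∎)
      where open import Relation.Binary.Reasoning.Setoid (T.setoid K₂)

    even-quotient : even (θ₋ ⊠ θ₁) ⊠ even D ≋[ K ] even (θ ⊠ θ₁)
    even-quotient = begin
      even (θ₋ ⊠ θ₁) ⊠ even D   ≈⟨ ≋⇒≋[] K (even-⊠ (θ₋ ⊠ θ₁) D (theta-alternating-odd torsion-free N)) ⟨
      even (θ₋ ⊠ θ₁ ⊠ D)        ≈⟨ ≋⇒≋[] K (λ i → R.xy∙z≈zx∙y θ₋ θ₁ D (2 ℕ.* i)) ⟩
      even (D ⊠ θ₋ ⊠ θ₁)        ≈⟨ even-truncated N (T.*-congʳ K₂ {x = θ₁} theta-quotient) ⟩
      even (θ ⊠ θ₁)             ∎
      where open import Relation.Binary.Reasoning.Setoid (T.setoid K)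

    squares : even D ⊠ (G₋ ⊠ G₋) ≋[ K ] (D ⊠ D) ⊠ (G₋ ⊠ G₋)
    squares = begin
      even D ⊠ (G₋ ⊠ G₋)
        ≈⟨ T.*-congˡ K {x = even D} (even-theta-square N alternating-solves S.refl) ⟨
      even D ⊠ (g ⊠ (g ⊠ even (θ₋ ⊠ θ₁)))
        ≈⟨ ≋⇒≋[] K (R.x∙yyz≈yy∙zx (even D) g (even (θ₋ ⊠ θ₁))) ⟩
      g ⊠ (g ⊠ (even (θ₋ ⊠ θ₁) ⊠ even D))
        ≈⟨ T.*-congˡ K {x = g} (T.*-congˡ K {x = g} even-quotient) ⟩
      g ⊠ (g ⊠ even (θ ⊠ θ₁))
        ≈⟨ even-theta-square N solves u₀ ⟩
      G ⊠ G
        ≈⟨ T.*-cong K (quotient-K) (quotient-K) ⟨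
      (D ⊠ G₋) ⊠ (D ⊠ G₋)
        ≈⟨ ≋⇒≋[] K (R.xy∙xy≈xx∙yy D G₋) ⟩
      (D ⊠ D) ⊠ (G₋ ⊠ G₋) ∎
      where
      open import Relation.Binary.Reasoning.Setoid (T.setoid K)
      quotient-K : D ⊠ G₋ ≋[ K ] G
      quotient-K = ≋[]-mono (ℕ.s≤s (ℕ.m≤m+n N N)) (quotient N)

-- The effect of one more part size on a generating function

module FactorRemoval {c ℓ} (R : CommutativeRing c ℓ) where
  open CommutativeRing R
  open SemiringSolver commutativeSemiring using (solve; _:=_; _:+_; _:*_; con)
  open import Relation.Binary.Reasoning.Setoid setoid

  -- Here m stands for −2; eliminating A and D gives
  -- B′ (1 − Q)² = B ((1 − Q)² + X Q).
  add-part-size : ∀ {B B′ A D Q X m} → (1# + 1#) + m ≈ 0# →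
    B′ ≈ B + A → A ≈ D + Q * A → D ≈ Q * (X * B) + Q * D →
    B′ * (1# + m * Q + Q * Q) ≈ B * (1# + (X + m) * Q + Q * Q)
  add-part-size {B} {B′} {A} {D} {Q} {X} {m} 2+m≈0 b a d = begin
    B′ * (1# + m * Q + Q * Q)
      ≈⟨ *-congʳ b ⟩
    (B + A) * (1# + m * Q + Q * Q)
      ≈⟨ solve 4 (λ B A m Q → (B :+ A) :* (con 1 :+ m :* Q :+ Q :* Q)
           := (B :* (con 1 :+ m :* Q :+ Q :* Q) :+ (m :* Q :* A :+ Q :* Q :* A)) :+ A) refl B A m Q ⟩
    (B * (1# + m * Q + Q * Q) + (m * Q * A + Q * Q * A)) + A
      -- Only the isolated A is expanded. This creates Q (D + Q A), which folds back to Q A and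
      -- leaves a multiple of 2 + m.
      ≈⟨ +-congˡ (trans a (+-congʳ d)) ⟩
    (B * (1# + m * Q + Q * Q) + (m * Q * A + Q * Q * A)) + ((Q * (X * B) + Q * D) + Q * A)
      ≈⟨ solve 6 (λ B A m Q X D →
           (B :* (con 1 :+ m :* Q :+ Q :* Q) :+ (m :* Q :* A :+ Q :* Q :* A)) :+ ((Q :* (X :* B) :+ Q :* D) :+ Q :* A)
           := (B :* (con 1 :+ (X :+ m) :* Q :+ Q :* Q) :+ (con 1 :+ m) :* (Q :* A)) :+ Q :* (D :+ Q :* A)) refl B A m Q X D ⟩
    (B * (1# + (X + m) * Q + Q * Q) + (1# + m) * (Q * A)) + Q * (D + Q * A)
      ≈⟨ +-congˡ (*-congˡ a) ⟨
    (B * (1# + (X + m) * Q + Q * Q) + (1# + m) * (Q * A)) + Q * A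
      ≈⟨ solve 5 (λ B A m Q X →
           (B :* (con 1 :+ (X :+ m) :* Q :+ Q :* Q) :+ (con 1 :+ m) :* (Q :* A)) :+ Q :* A
           := B :* (con 1 :+ (X :+ m) :* Q :+ Q :* Q) :+ ((con 1 :+ con 1) :+ m) :* (Q :* A)) refl B A m Q X ⟩
    B * (1# + (X + m) * Q + Q * Q) + ((1# + 1#) + m) * (Q * A)
      ≈⟨ +-congˡ (trans (*-congʳ 2+m≈0) (zeroˡ _)) ⟩
    B * (1# + (X + m) * Q + Q * Q) + 0#
      ≈⟨ +-identityʳ _ ⟩
    B * (1# + (X + m) * Q + Q * Q) ∎

  product-step : ∀ {B B′ G G₋ f f₋} → B * G₋ ≈ G → B′ * f₋ ≈ B * f → B′ * (G₋ * f₋) ≈ G * f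
  product-step {B} {B′} {G} {G₋} {f} {f₋} p s = begin
    B′ * (G₋ * f₋) ≈⟨ solve 3 (λ B′ G₋ f₋ → B′ :* (G₋ :* f₋) := (B′ :* f₋) :* G₋) refl B′ G₋ f₋ ⟩
    (B′ * f₋) * G₋ ≈⟨ *-congʳ s ⟩
    (B * f) * G₋   ≈⟨ solve 3 (λ B f G₋ → (B :* f) :* G₋ := (B :* G₋) :* f) refl B f G₋ ⟩
    (B * G₋) * f   ≈⟨ *-congʳ p ⟩
    G * f          ∎

-- A solution of the recurrence without division

module Chebyshev {c ℓ} (S : CommutativeRing c ℓ) (y : CommutativeRing.Carrier S) where
  open PowerSeries S using (const; const-+; const-*; const-cong; seriesRing; q)
  open FiniteTripleProduct seriesRing q using (Solves)
  private
    module S = CommutativeRing S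
    module P = CommutativeRing seriesRing
  open import Algebra.Properties.Ring S.ring using (//-rightDividesˡ)

  recurrent : S.Carrier → S.Carrier → ℕ → S.Carrier
  recurrent a b zero          = a
  recurrent a b (suc zero)    = b
  recurrent a b (suc (suc n)) = y S.* recurrent a b (suc n) S.- recurrent a b n

  chebyshev : ℤ → S.Carrier
  chebyshev (+ n)    = recurrent S.1# y n
  chebyshev -[1+ n ] = recurrent S.0# (S.- S.1#) n

  chebyshev-recurrence : ∀ k → chebyshev (ℤ.suc k) S.+ chebyshev (ℤ.pred k) S.≈ y S.* chebyshev k
  chebyshev-recurrence (+ zero)        = S.trans (S.+-identityʳ y) (S.sym (S.*-identityʳ y))
  chebyshev-recurrence (+ suc n)       = //-rightDividesˡ (recurrent S.1# y n) _
  chebyshev-recurrence -[1+ zero ]     = S.trans (S.-‿inverseʳ S.1#) (S.sym (S.zeroʳ y))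
  chebyshev-recurrence -[1+ suc n ]    =
    S.trans (S.+-comm _ _) (//-rightDividesˡ (recurrent S.0# (S.- S.1#) n) _)

  chebyshev-solves : Solves (const y) (const ∘ chebyshev)
  chebyshev-solves k = P.trans (P.sym (const-+ _ _)) (P.trans (const-cong (chebyshev-recurrence k)) (const-* y _))

open import Defs
open import Data.Nat using (_*_; _∸_)

-- Removing the largest part of a PDO partition

Starts : Occurrence → List Occurrence → Set
Starts o []       = ⊥
Starts o (o′ ∷ _) = o′ ≡ o

starts? : ∀ o → Decidable (Starts o)
starts? o []       = no λ ()
starts? o (o′ ∷ _) = o′ ≟ᵒ o

StartsPart : ℕ → List Occurrence → Set
StartsPart p []            = ⊥
StartsPart p ((p′ , _) ∷ _) = p′ ≡ p

startsPart? : ∀ p → Decidable (StartsPart p)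
startsPart? p []            = no λ ()
startsPart? p ((p′ , _) ∷ _) = p′ ℕ.≟ p

Head≤ : ℕ → List Occurrence → Set
Head≤ k []            = ⊤
Head≤ k ((p , _) ∷ _) = p ℕ.≤ k

head≤? : ∀ k → Decidable (Head≤ k)
head≤? k []            = yes tt
head≤? k ((p , _) ∷ _) = p ℕ.≤? k

designations-false : ∀ p m λs → designations p ((m , false) ∷ λs) ≡ designations p λs
designations-false p m λs = ≡.cong length (filter-reject (_≟ᵒ (p , true)) {m , false} {λs} λ ())

designations-same : ∀ m λs → designations m ((m , true) ∷ λs) ≡ suc (designations m λs)
designations-same m λs = ≡.cong length (filter-accept (_≟ᵒ (m , true)) {xs = λs} ≡.refl)

designations-other : ∀ {p m} b λs → m ≢ p → designations p ((m , b) ∷ λs) ≡ designations p λs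
designations-other {p} {m} b λs m≢p = ≡.cong length (filter-reject (_≟ᵒ (p , true)) {m , b} {λs} λ { ≡.refl → m≢p ≡.refl })

filter-insert : ∀ {A : Set} {P : A → Set} (P? : Decidable P) x {y} zs → ¬ P y →
                filter P? (x ∷ y ∷ zs) ≡ filter P? (x ∷ zs)
filter-insert P? x zs ¬Py with does (P? x)
... | true  = ≡.cong (x ∷_) (filter-reject P? ¬Py)
... | false = filter-reject P? ¬Py

designations-insert : ∀ p o m λs → designations p (o ∷ (m , false) ∷ λs) ≡ designations p (o ∷ λs)
designations-insert p o m λs = ≡.cong length (filter-insert (_≟ᵒ (p , true)) o λs λ ())

designations-absent : ∀ {m} λs → All (ℕ._< m) (parts λs) → designations m λs ≡ 0
designations-absent []             []         = ≡.refl
designations-absent ((p , b) ∷ λs) (p<m ∷ ps) =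
  ≡.trans (designations-other b λs (ℕ.<⇒≢ p<m)) (designations-absent λs ps)

decreasing⇒all≤ : ∀ {m ps} → Linked _≥_ (m ∷ ps) → All (ℕ._≤ m) ps
decreasing⇒all≤ [-]       = []
decreasing⇒all≤ (m≥p ∷ l) = Linked⇒All (λ i≥j j≥k → ℕ.≤-trans j≥k i≥j) m≥p l

head≤⇒all≤ : ∀ {k} λs → Linked _≥_ (parts λs) → Head≤ k λs → All (ℕ._≤ k) (parts λs)
head≤⇒all≤ []             _ _   = []
head≤⇒all≤ ((p , b) ∷ λs) l p≤k = p≤k ∷ All.map (λ p′≤p → ℕ.≤-trans p′≤p p≤k) (decreasing⇒all≤ l)

all≤⇒decreasing : ∀ {m} λs → Linked _≥_ (parts λs) → Head≤ m λs → Linked _≥_ (m ∷ parts λs)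
all≤⇒decreasing []       _ _   = [-]
all≤⇒decreasing (_ ∷ λs) l p≤m = p≤m ∷ l

tail-decreasing : ∀ {p ps} → Linked _≥_ (p ∷ ps) → Linked _≥_ ps
tail-decreasing [-]     = []
tail-decreasing (_ ∷ l) = l

module _ {m : ℕ} where
  -- An undesignated leading m needs a designated m further on, and in a weakly decreasing list this
  -- forces the next part to be m too.
  cons-false⁻ : ∀ λs → IsPDO ((m , false) ∷ λs) → IsPDO λs × StartsPart m λs
  cons-false⁻ λs (mkPDO l (_ ∷ odd) (d ∷ ds)) =
    mkPDO (tail-decreasing l) odd (All.map (λ {p} e → ≡.trans (≡.sym (designations-false p m λs)) e) ds) ,
    starts λs l (≡.trans (≡.sym (designations-false m m λs)) d)
    where
    starts : ∀ λs → Linked _≥_ (m ∷ parts λs) → designations m λs ≡ 1 → StartsPart m λs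
    starts []             _         ()
    starts ((p , b) ∷ λs) (m≥p ∷ l) d with ℕ.m≤n⇒m<n∨m≡n m≥p
    ... | inj₂ p≡m = p≡m
    ... | inj₁ p<m = contradiction (≡.trans (≡.sym absent) d) λ ()
      where
      absent : designations m ((p , b) ∷ λs) ≡ 0
      absent = designations-absent ((p , b) ∷ λs)
        (p<m ∷ All.map (λ p′≤p → ℕ.≤-<-trans p′≤p p<m) (decreasing⇒all≤ l))

  cons-false⁺ : ∀ λs → IsPDO λs → StartsPart m λs → IsPDO ((m , false) ∷ λs)
  cons-false⁺ λs@((_ , b) ∷ _) (mkPDO l (o ∷ odd) (d ∷ ds)) ≡.refl = mkPDO (ℕ.≤-refl ∷ l) (o ∷ o ∷ odd)
    (lift d ∷ lift d ∷ All.map lift ds)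
    where
    lift : ∀ {p} → designations p λs ≡ 1 → designations p ((m , false) ∷ λs) ≡ 1
    lift {p} = ≡.trans (designations-false p m λs)

  insert-false⁺ : ∀ λs → IsPDO ((m , true) ∷ λs) → IsPDO ((m , true) ∷ (m , false) ∷ λs)
  insert-false⁺ λs (mkPDO l (o ∷ odd) (d ∷ ds)) = mkPDO (ℕ.≤-refl ∷ l) (o ∷ o ∷ odd) (lift d ∷ lift d ∷ All.map lift ds)
    where
    lift : ∀ {p} → designations p ((m , true) ∷ λs) ≡ 1 → designations p ((m , true) ∷ (m , false) ∷ λs) ≡ 1
    lift {p} = ≡.trans (designations-insert p (m , true) m λs)

  insert-false⁻ : ∀ λs → IsPDO ((m , true) ∷ (m , false) ∷ λs) → IsPDO ((m , true) ∷ λs)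
  insert-false⁻ λs (mkPDO (_ ∷ l) (_ ∷ odd) (_ ∷ ds)) = mkPDO l odd
    (All.map (λ {p} → ≡.trans (≡.sym (designations-insert p (m , true) m λs))) ds)

  cons-true⁺ : ∀ λs → 2 ∤ m → IsPDO λs → All (ℕ._< m) (parts λs) → IsPDO ((m , true) ∷ λs)
  cons-true⁺ λs 2∤m (mkPDO l odd ds) below = mkPDO (all≤⇒decreasing λs l (head λs below)) (2∤m ∷ odd)
    (≡.trans (designations-same m λs) (≡.cong suc (designations-absent λs below)) ∷
     All.zipWith (λ (p<m , d) → ≡.trans (designations-other true λs (ℕ.>⇒≢ p<m)) d) (below , ds))
    where
    head : ∀ λs → All (ℕ._< m) (parts λs) → Head≤ m λs
    head []      _         = tt
    head (_ ∷ _) (p<m ∷ _) = ℕ.<⇒≤ p<m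

  -- If m occurs again, it does so in second position, and there it cannot be designated a second
  -- time.
  cons-true⁻ : ∀ λs → IsPDO ((m , true) ∷ λs) →
    (IsPDO λs × All (ℕ._< m) (parts λs)) ⊎ ∃ λ μs → λs ≡ (m , false) ∷ μs
  cons-true⁻ []             _ = inj₁ (mkPDO [] [] [] , [])
  cons-true⁻ ((p , b) ∷ λs) (mkPDO (m≥p ∷ l) (_ ∷ odd) (d ∷ ds)) with ℕ.m≤n⇒m<n∨m≡n m≥p
  cons-true⁻ ((p , false) ∷ λs) _ | inj₂ ≡.refl = inj₂ (λs , ≡.refl)
  cons-true⁻ ((p , true) ∷ λs) (mkPDO _ _ (d ∷ _)) | inj₂ ≡.refl = contradiction
    (≡.trans (≡.sym (≡.trans (designations-same m ((m , true) ∷ λs)) (≡.cong suc (designations-same m λs)))) d) λ ()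
  ... | inj₁ p<m = inj₁ (mkPDO l odd (All.zipWith (λ (p<m , d) →
                   ≡.trans (≡.sym (designations-other true ((p , b) ∷ λs) (ℕ.>⇒≢ p<m))) d) (below , ds)) , below)
    where
    below = p<m ∷ All.map (λ p′≤p → ℕ.≤-<-trans p′≤p p<m) (decreasing⇒all≤ l)

deduplicate-repeat : ∀ m ps → deduplicate ℕ._≟_ (m ∷ m ∷ ps) ≡ deduplicate ℕ._≟_ (m ∷ ps)
deduplicate-repeat m ps = ≡.cong (m ∷_) (≡.trans
  (filter-reject (λ p → ¬? (m ℕ.≟ p)) {xs = filter (λ p → ¬? (m ℕ.≟ p)) (deduplicate ℕ._≟_ ps)} (λ m≢m → m≢m ≡.refl))
  (filter-idem (λ p → ¬? (m ℕ.≟ p)) (deduplicate ℕ._≟_ ps)))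

ℓd-repeat : ∀ {m b b′} λs → ℓd ((m , b) ∷ (m , b′) ∷ λs) ≡ ℓd ((m , b′) ∷ λs)
ℓd-repeat {m} λs = ≡.cong length (deduplicate-repeat m (parts λs))

ℓd-new : ∀ {m b} λs → All (ℕ._< m) (parts λs) → ℓd ((m , b) ∷ λs) ≡ suc (ℓd λs)
ℓd-new {m} λs below = ≡.cong (suc ∘ length) (filter-all (λ p → ¬? (m ℕ.≟ p))
  (All.tabulate λ p∈ → ℕ.>⇒≢ (All.lookup below (∈-deduplicate⁻ ℕ._≟_ (parts λs) p∈))))

-- With Q = q^m and m = 2M + 1, the generating functions B of `below (2 ℕ.* M)`, A of `starting m`
-- and D of `designatedFirst m` satisfy A = D + Q A and D = Q x B + Q D, while B + A belongs to the
-- next bound. Eliminating A and D yields the factor 1 + x Q / (1 - Q)².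
below : ℕ → ℕ → List (List Occurrence)
below k n = filter (head≤? k) (PDO n)

starting : ℕ → ℕ → List (List Occurrence)
starting m n = filter (startsPart? m) (PDO n)

designatedFirst : ℕ → ℕ → List (List Occurrence)
designatedFirst m n = filter (starts? (m , true)) (PDO n)

∈-filter-PDO : ∀ {P : List Occurrence → Set} (P? : Decidable P) n λs →
               λs ∈ filter P? (PDO n) ⇔ (IsPDOOf n λs × P λs)
∈-filter-PDO P? n λs = mk⇔
  (λ λs∈ → let ∈PDO , p = ∈-filter⁻ P? {xs = PDO n} λs∈ in to (∈-PDO n λs) ∈PDO , p)
  (λ (isPDO , p) → ∈-filter⁺ P? (from (∈-PDO n λs) isPDO) p)

below-odd : ∀ M {p} → 2 ∤ p → p ℕ.≤ 2 ℕ.* suc M → p ℕ.≤ 2 ℕ.* M ⊎ p ≡ suc (2 ℕ.* M)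
below-odd M {p} 2∤p p≤ with ℕ.m≤n⇒m<n∨m≡n (≡.subst (p ℕ.≤_) (ℕ.*-suc 2 M) p≤)
... | inj₂ ≡.refl = contradiction (≡.subst (2 ∣_) (ℕ.*-suc 2 M) (m∣m*n (suc M))) 2∤p
... | inj₁ p<   with ℕ.m≤n⇒m<n∨m≡n (ℕ.s≤s⁻¹ p<)
...   | inj₁ p<′ = inj₁ (ℕ.s≤s⁻¹ p<′)
...   | inj₂ p≡  = inj₂ p≡

odd-2M+1 : ∀ M → 2 ∤ suc (2 ℕ.* M)
odd-2M+1 M 2∣ = contradiction (∣1⇒≡1 (∣m+n∣m⇒∣n (≡.subst (2 ∣_) (ℕ.+-comm 1 (2 ℕ.* M)) 2∣) (m∣m*n M))) λ ()

-- The counterpart of multiplication by q^m on families of lists. The recursion yields the empty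
-- list for n < m, where `n ∸ m` would wrongly give index 0.
shifted : {A : Set} → ℕ → (ℕ → List A) → ℕ → List A
shifted zero    L n       = L n
shifted (suc m) L zero    = []
shifted (suc m) L (suc n) = shifted m L n

∈-shifted⁻ : ∀ {A : Set} m L n {a : A} → a ∈ shifted m L n → ∃ λ k → m ℕ.+ k ≡ n × a ∈ L k
∈-shifted⁻ zero    L n       a∈ = n , ≡.refl , a∈
∈-shifted⁻ (suc m) L (suc n) a∈ = case ∈-shifted⁻ m L n a∈ of λ { (k , ≡.refl , a∈′) → k , ≡.refl , a∈′ }

∈-shifted⁺ : ∀ {A : Set} m L k {a : A} → a ∈ L k → a ∈ shifted m L (m ℕ.+ k)
∈-shifted⁺ zero    L k a∈ = a∈
∈-shifted⁺ (suc m) L k a∈ = ∈-shifted⁺ m L k a∈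

shifted-unique : ∀ {A : Set} m (L : ℕ → List A) n → (∀ k → Unique (L k)) → Unique (shifted m L n)
shifted-unique zero    L n       u = u n
shifted-unique (suc m) L zero    u = []
shifted-unique (suc m) L (suc n) u = shifted-unique m L n u

-- The copy goes behind the head, so that the designated occurrence stays first. No member of
-- `designatedFirst` is empty; the value at `[]` merely keeps the map injective.
insertFalse : ℕ → List Occurrence → List Occurrence
insertFalse m []       = []
insertFalse m (o ∷ λs) = o ∷ (m , false) ∷ λs

insertFalse-injective : ∀ {m λs μs} → insertFalse m λs ≡ insertFalse m μs → λs ≡ μs
insertFalse-injective {λs = []}    {[]}    _    = ≡.refl
insertFalse-injective {λs = _ ∷ _} {_ ∷ _} ≡.refl = ≡.refl

∈-below-suc : ∀ M n λs → λs ∈ below (2 ℕ.* suc M) n ⇔ (λs ∈ below (2 ℕ.* M) n ⊎ λs ∈ starting (suc (2 ℕ.* M)) n)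
∈-below-suc M n λs = mk⇔ forward backward
  where
  2M≤ : suc (2 ℕ.* M) ℕ.≤ 2 ℕ.* suc M
  2M≤ = ≡.subst (suc (2 ℕ.* M) ℕ.≤_) (≡.sym (ℕ.*-suc 2 M)) (ℕ.n≤1+n _)
  split : ∀ λs → IsPDO λs → Head≤ (2 ℕ.* suc M) λs → Head≤ (2 ℕ.* M) λs ⊎ StartsPart (suc (2 ℕ.* M)) λs
  split []            _                  _  = inj₁ tt
  split ((p , _) ∷ _) (mkPDO _ (2∤p ∷ _) _) p≤ = below-odd M 2∤p p≤
  forward : λs ∈ below (2 ℕ.* suc M) n → λs ∈ below (2 ℕ.* M) n ⊎ λs ∈ starting (suc (2 ℕ.* M)) n
  forward m with to (∈-filter-PDO (head≤? _) n λs) m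
  ... | (pdo , w) , h with split λs pdo h
  ...   | inj₁ h′ = inj₁ (from (∈-filter-PDO (head≤? _) n λs) ((pdo , w) , h′))
  ...   | inj₂ s  = inj₂ (from (∈-filter-PDO (startsPart? _) n λs) ((pdo , w) , s))
  weaken : ∀ λs → Head≤ (2 ℕ.* M) λs → Head≤ (2 ℕ.* suc M) λs
  weaken []      _ = tt
  weaken (_ ∷ _) h = ℕ.≤-trans h (ℕ.≤-trans (ℕ.n≤1+n _) 2M≤)
  starts⇒head≤ : ∀ λs → StartsPart (suc (2 ℕ.* M)) λs → Head≤ (2 ℕ.* suc M) λs
  starts⇒head≤ (_ ∷ _) ≡.refl = 2M≤
  backward : λs ∈ below (2 ℕ.* M) n ⊎ λs ∈ starting (suc (2 ℕ.* M)) n → λs ∈ below (2 ℕ.* suc M) n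
  backward (inj₁ m) = let pdo , h = to (∈-filter-PDO (head≤? _) n λs) m
                      in from (∈-filter-PDO (head≤? _) n λs) (pdo , weaken λs h)
  backward (inj₂ m) = let pdo , s = to (∈-filter-PDO (startsPart? _) n λs) m
                      in from (∈-filter-PDO (head≤? _) n λs) (pdo , starts⇒head≤ λs s)

below-starting-disjoint : ∀ M n λs → λs ∈ below (2 ℕ.* M) n → λs ∈ starting (suc (2 ℕ.* M)) n → ⊥
below-starting-disjoint M n λs m m′ =
  apart λs (proj₂ (to (∈-filter-PDO (head≤? _) n λs) m)) (proj₂ (to (∈-filter-PDO (startsPart? _) n λs) m′))
  where
  apart : ∀ λs → Head≤ (2 ℕ.* M) λs → StartsPart (suc (2 ℕ.* M)) λs → ⊥
  apart (_ ∷ _) h ≡.refl = ℕ.1+n≰n h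

-- Either the leading m is designated, or it can be deleted and the rest still starts with m.
∈-starting : ∀ m n λs → λs ∈ starting m n ⇔
  (λs ∈ designatedFirst m n ⊎ λs ∈ map ((m , false) ∷_) (shifted m (starting m) n))
∈-starting m n λs = mk⇔ (λ λs∈ → forward λs (to (∈-filter-PDO (startsPart? m) n λs) λs∈)) backward
  where
  forward : ∀ λs → IsPDOOf n λs × StartsPart m λs →
            λs ∈ designatedFirst m n ⊎ λs ∈ map ((m , false) ∷_) (shifted m (starting m) n)
  forward ((_ , true)  ∷ λs) (pdo , ≡.refl) = inj₁ (from (∈-filter-PDO (starts? (m , true)) n _) (pdo , ≡.refl))
  forward ((_ , false) ∷ λs) ((pdo , ≡.refl) , ≡.refl) = let pdo′ , s = cons-false⁻ λs pdo in
    inj₂ (∈-map⁺ _ (∈-shifted⁺ m (starting m) (weight λs)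
      (from (∈-filter-PDO (startsPart? m) (weight λs) λs) ((pdo′ , ≡.refl) , s))))
  starts : ∀ λs → Starts (m , true) λs → StartsPart m λs
  starts (_ ∷ _) ≡.refl = ≡.refl
  backward : λs ∈ designatedFirst m n ⊎ λs ∈ map ((m , false) ∷_) (shifted m (starting m) n) → λs ∈ starting m n
  backward (inj₁ λs∈) = let pdo , s = to (∈-filter-PDO (starts? (m , true)) n λs) λs∈
                        in from (∈-filter-PDO (startsPart? m) n λs) (pdo , starts λs s)
  backward (inj₂ λs∈) = case ∈-map⁻ _ λs∈ of λ { (μs , μs∈ , ≡.refl) →
    case ∈-shifted⁻ m (starting m) n μs∈ of λ { (k , ≡.refl , μs∈′) →
    case to (∈-filter-PDO (startsPart? m) k μs) μs∈′ of λ { ((pdo , ≡.refl) , s) →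
    from (∈-filter-PDO (startsPart? m) n λs) ((cons-false⁺ μs pdo s , ≡.refl) , ≡.refl) } } }

starting-disjoint : ∀ m n λs → λs ∈ designatedFirst m n → λs ∈ map ((m , false) ∷_) (shifted m (starting m) n) → ⊥
starting-disjoint m n λs λs∈ λs∈′ = case ∈-map⁻ _ λs∈′ of λ { (_ , _ , ≡.refl) →
  case proj₂ (to (∈-filter-PDO (starts? (m , true)) n λs) λs∈) of λ () }

-- Either the designated m is the only m, and deleting it leaves parts of size at most 2M, or an
-- undesignated m follows, and that one is deleted.
∈-designatedFirst : ∀ M n λs → let m = suc (2 ℕ.* M) in
  λs ∈ designatedFirst m n ⇔
  (λs ∈ map ((m , true) ∷_) (shifted m (below (2 ℕ.* M)) n) ⊎ λs ∈ map (insertFalse m) (shifted m (designatedFirst m) n))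
∈-designatedFirst M n λs = mk⇔ (λ λs∈ → forward λs (to (∈-filter-PDO (starts? (m , true)) n λs) λs∈)) backward
  where
  m = suc (2 ℕ.* M)
  all<⇒head≤ : ∀ λs → All (ℕ._< m) (parts λs) → Head≤ (2 ℕ.* M) λs
  all<⇒head≤ []      _         = tt
  all<⇒head≤ (_ ∷ _) (p<m ∷ _) = ℕ.s≤s⁻¹ p<m
  forward : ∀ λs → IsPDOOf n λs × Starts (m , true) λs →
    λs ∈ map ((m , true) ∷_) (shifted m (below (2 ℕ.* M)) n) ⊎ λs ∈ map (insertFalse m) (shifted m (designatedFirst m) n)
  forward (_ ∷ λs) ((pdo , ≡.refl) , ≡.refl) with cons-true⁻ λs pdo
  ... | inj₁ (pdo′ , all<) = inj₁ (∈-map⁺ _ (∈-shifted⁺ m (below (2 ℕ.* M)) (weight λs)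
    (from (∈-filter-PDO (head≤? (2 ℕ.* M)) (weight λs) λs) ((pdo′ , ≡.refl) , all<⇒head≤ λs all<))))
  ... | inj₂ (μs , ≡.refl)   = inj₂ (∈-map⁺ (insertFalse m) (∈-shifted⁺ m (designatedFirst m) (m ℕ.+ weight μs)
    (from (∈-filter-PDO (starts? (m , true)) (m ℕ.+ weight μs) ((m , true) ∷ μs)) ((insert-false⁻ μs pdo , ≡.refl) , ≡.refl))))
  insert : ∀ k μs → IsPDOOf k μs × Starts (m , true) μs → insertFalse m μs ∈ designatedFirst m (m ℕ.+ k)
  insert k (_ ∷ μs) ((pdo , ≡.refl) , ≡.refl) =
    from (∈-filter-PDO (starts? (m , true)) _ ((m , true) ∷ (m , false) ∷ μs)) ((insert-false⁺ μs pdo , ≡.refl) , ≡.refl)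
  backward : λs ∈ map ((m , true) ∷_) (shifted m (below (2 ℕ.* M)) n) ⊎ λs ∈ map (insertFalse m) (shifted m (designatedFirst m) n) →
    λs ∈ designatedFirst m n
  backward (inj₁ λs∈) = case ∈-map⁻ _ λs∈ of λ { (μs , μs∈ , ≡.refl) →
    case ∈-shifted⁻ m (below (2 ℕ.* M)) n μs∈ of λ { (k , ≡.refl , μs∈′) →
    case to (∈-filter-PDO (head≤? (2 ℕ.* M)) k μs) μs∈′ of λ { ((pdo , ≡.refl) , h) →
    from (∈-filter-PDO (starts? (m , true)) n λs)
      ((cons-true⁺ μs (odd-2M+1 M) pdo (All.map ℕ.s≤s (head≤⇒all≤ μs (IsPDO.decreasing pdo) h)) , ≡.refl) , ≡.refl) } } }
  backward (inj₂ λs∈) = case ∈-map⁻ _ λs∈ of λ { (μs , μs∈ , ≡.refl) →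
    case ∈-shifted⁻ m (designatedFirst m) n μs∈ of λ { (k , ≡.refl , μs∈′) →
    insert k μs (to (∈-filter-PDO (starts? (m , true)) k μs) μs∈′) } }

designatedFirst-disjoint : ∀ M n λs → let m = suc (2 ℕ.* M) in
  λs ∈ map ((m , true) ∷_) (shifted m (below (2 ℕ.* M)) n) → λs ∈ map (insertFalse m) (shifted m (designatedFirst m) n) → ⊥
designatedFirst-disjoint M n λs λs∈ λs∈′ = case ∈-map⁻ _ λs∈ of λ { (μs , μs∈ , ≡.refl) →
  case ∈-map⁻ (insertFalse m) λs∈′ of λ { (_ ∷ νs , _ , ≡.refl) →
  case ∈-shifted⁻ m (below (2 ℕ.* M)) n μs∈ of λ { (k , _ , μs∈′) →
  ℕ.1+n≰n (proj₂ (to (∈-filter-PDO (head≤? (2 ℕ.* M)) k μs) μs∈′)) } } }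
  where m = suc (2 ℕ.* M)

-- The product formula for PDO partitions

module PDOProduct {c ℓ} (S : CommutativeRing c ℓ) (x : CommutativeRing.Carrier S) where
  open PowerSeries S
  open FiniteTripleProduct seriesRing q using (oddProduct)
  open EvenPart S using (-2P)
  private
    module S = CommutativeRing S
    module P = CommutativeRing seriesRing
    module ΣS = Sums S
  open import Algebra.Properties.Semiring.Exp P.semiring using (_^_)
  open import Algebra.Properties.Semiring.Exp S.semiring using () renaming (_^_ to _^ₓ_)
  open import Relation.Binary.Reasoning.Setoid S.setoid

  term : List Occurrence → S.Carrier
  term λs = x ^ₓ ℓd λs

  generating : (ℕ → List (List Occurrence)) → Coeffs
  generating L n = ΣS.Σ[ L n ] term

  Σ-shifted : ∀ {A : Set} m (L : ℕ → List A) (f : A → S.Carrier) n →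
              ΣS.Σ[ shifted m L n ] f S.≈ (q ^ m ⊠ (λ k → ΣS.Σ[ L k ] f)) n
  Σ-shifted zero    L f n       = S.sym (P.*-identityˡ (λ k → ΣS.Σ[ L k ] f) n)
  Σ-shifted (suc m) L f zero    = S.sym (S.trans (P.*-assoc q (q ^ m) (λ k → ΣS.Σ[ L k ] f) 0) (q-⊠-zero (q ^ m ⊠ (λ k → ΣS.Σ[ L k ] f))))
  Σ-shifted (suc m) L f (suc n) = S.trans (Σ-shifted m L f n)
    (S.sym (S.trans (P.*-assoc q (q ^ m) (λ k → ΣS.Σ[ L k ] f) (suc n)) (q-⊠-suc _ n)))

  Σ-disjoint : ∀ {A : Set} {as bs cs : List A} f → Unique as → Unique bs → Unique cs →
    (∀ a → a ∈ cs ⇔ (a ∈ as ⊎ a ∈ bs)) → (∀ a → a ∈ as → a ∈ bs → ⊥) →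
    ΣS.Σ[ cs ] f S.≈ ΣS.Σ[ as ] f S.+ ΣS.Σ[ bs ] f
  Σ-disjoint {as = as} {bs} f ua ub uc split disjoint = S.trans
    (ΣS.Σ-unique f uc (Unique.++⁺ ua ub (λ {a} (a∈as , a∈bs) → disjoint a a∈as a∈bs))
      (λ {a} → mk⇔ (λ a∈ → [ ∈-++⁺ˡ , ∈-++⁺ʳ as ]′ (to (split a) a∈)) (λ a∈ → from (split a) (∈-++⁻ as a∈))))
    (ΣS.Σ-++ as bs f)

  Σ-map-shifted : ∀ {h : List Occurrence → List Occurrence} m L s n →
    (∀ k λs → λs ∈ L k → term (h λs) S.≈ s S.* term λs) →
    ΣS.Σ[ map h (shifted m L n) ] term S.≈ (q ^ m ⊠ (const s ⊠ generating L)) n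
  Σ-map-shifted {h} m L s n scale = begin
    ΣS.Σ[ map h (shifted m L n) ] term             ≡⟨ ΣS.Σ-map h (shifted m L n) term ⟩
    ΣS.Σ[ shifted m L n ] (term ∘ h)               ≈⟨ Σ-shifted m L (term ∘ h) n ⟩
    (q ^ m ⊠ (λ k → ΣS.Σ[ L k ] (term ∘ h))) n     ≈⟨ P.*-congˡ {x = q ^ m} scaled n ⟩
    (q ^ m ⊠ (const s ⊠ generating L)) n           ∎
    where
    scaled : (λ k → ΣS.Σ[ L k ] (term ∘ h)) ≋ const s ⊠ generating L
    scaled k = S.trans (ΣS.Σ-cong-∈ (L k) (λ {λs} λs∈ → scale k λs λs∈))
      (S.trans (ΣS.Σ-*ˡ s (L k) term) (S.sym (const-⊠ s (generating L) k)))

  below-unique : ∀ k n → Unique (below k n)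
  below-unique k n = Unique.filter⁺ (head≤? k) (PDO-unique n)

  starting-unique : ∀ m n → Unique (starting m n)
  starting-unique m n = Unique.filter⁺ (startsPart? m) (PDO-unique n)

  designatedFirst-unique : ∀ m n → Unique (designatedFirst m n)
  designatedFirst-unique m n = Unique.filter⁺ (starts? (m , true)) (PDO-unique n)

  same-ℓd : ∀ {λs μs} → ℓd λs ≡ ℓd μs → term λs S.≈ S.1# S.* term μs
  same-ℓd e = S.trans (S.reflexive (≡.cong (x ^ₓ_) e)) (S.sym (S.*-identityˡ _))

  unscale : ∀ m F → q ^ m ⊠ (const S.1# ⊠ F) ≋ q ^ m ⊠ F
  unscale m F = P.*-congˡ (P.*-identityˡ F)

  module _ (M : ℕ) where
    private m = suc (2 ℕ.* M)

    below-step : generating (below (2 ℕ.* suc M)) ≋ generating (below (2 ℕ.* M)) ⊞ generating (starting m)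
    below-step n = Σ-disjoint term (below-unique _ n) (starting-unique m n) (below-unique _ n)
      (∈-below-suc M n) (below-starting-disjoint M n)

    starting-step : generating (starting m) ≋ generating (designatedFirst m) ⊞ (q ^ m ⊠ generating (starting m))
    starting-step n = S.trans
      (Σ-disjoint term (designatedFirst-unique m n)
        (Unique.map⁺ (λ { ≡.refl → ≡.refl }) (shifted-unique m (starting m) n (starting-unique m)))
        (starting-unique m n) (∈-starting m n) (starting-disjoint m n))
      (S.+-congˡ (S.trans (Σ-map-shifted m (starting m) S.1# n repeat) (unscale m (generating (starting m)) n)))
      where
      repeat : ∀ k λs → λs ∈ starting m k → term ((m , false) ∷ λs) S.≈ S.1# S.* term λs
      repeat k λs λs∈ = same-ℓd {(m , false) ∷ λs} {λs} (go λs (proj₂ (to (∈-filter-PDO (startsPart? m) k λs) λs∈)))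
        where
        go : ∀ λs → StartsPart m λs → ℓd ((m , false) ∷ λs) ≡ ℓd λs
        go ((_ , b) ∷ λs) ≡.refl = ℓd-repeat {m} {false} {b} λs

    designatedFirst-step : generating (designatedFirst m)
      ≋ (q ^ m ⊠ (const x ⊠ generating (below (2 ℕ.* M)))) ⊞ (q ^ m ⊠ generating (designatedFirst m))
    designatedFirst-step n = S.trans
      (Σ-disjoint term
        (Unique.map⁺ (λ { ≡.refl → ≡.refl }) (shifted-unique m (below (2 ℕ.* M)) n (below-unique (2 ℕ.* M))))
        (Unique.map⁺ insertFalse-injective (shifted-unique m (designatedFirst m) n (designatedFirst-unique m)))
        (designatedFirst-unique m n) (∈-designatedFirst M n) (designatedFirst-disjoint M n))
      (S.+-cong (Σ-map-shifted m (below (2 ℕ.* M)) x n new)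
        (S.trans (Σ-map-shifted m (designatedFirst m) S.1# n repeat) (unscale m (generating (designatedFirst m)) n)))
      where
      new : ∀ k λs → λs ∈ below (2 ℕ.* M) k → term ((m , true) ∷ λs) S.≈ x S.* term λs
      new k λs λs∈ = let (pdo , _) , h = to (∈-filter-PDO (head≤? (2 ℕ.* M)) k λs) λs∈ in
        S.reflexive (≡.cong (x ^ₓ_) (ℓd-new {m} {true} λs (All.map ℕ.s≤s (head≤⇒all≤ λs (IsPDO.decreasing pdo) h))))
      repeat : ∀ k λs → λs ∈ designatedFirst m k → term (insertFalse m λs) S.≈ S.1# S.* term λs
      repeat k λs λs∈ = same-ℓd {insertFalse m λs} {λs} (go λs (proj₂ (to (∈-filter-PDO (starts? (m , true)) k λs) λs∈)))
        where
        go : ∀ λs → Starts (m , true) λs → ℓd (insertFalse m λs) ≡ ℓd λs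
        go (_ ∷ λs) ≡.refl = ℓd-repeat {m} {true} {false} λs

  y : S.Carrier
  y = x S.- (S.1# S.+ S.1#)

  const-y : const y ≋ const x ⊞ -2P
  const-y = P.trans (const-+ x _) (P.+-congˡ (P.trans (const-neg _) (P.-‿cong (const-+ S.1# S.1#))))

  below-zero : generating (below 0) ≋ P.1#
  below-zero zero    = S.+-identityʳ _
  below-zero (suc n) = ΣS.Σ-unique term (below-unique 0 (suc n)) [] (λ {λs} → mk⇔ (λ m → none λs m) (λ ()))
    where
    none : ∀ λs → λs ∈ below 0 (suc n) → λs ∈ []
    none λs λs∈ = go λs (to (∈-filter-PDO (head≤? 0) (suc n) λs) λs∈)
      where
      go : ∀ λs → IsPDOOf (suc n) λs × Head≤ 0 λs → λs ∈ []
      go []             ((_ , ()) , _)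
      go ((zero , _) ∷ _) ((mkPDO _ (2∤0 ∷ _) _ , _) , _) = contradiction (2 ∣0) 2∤0

  -- The product over part sizes, cross-multiplied: at y = -2 the factors are 1 - 2 q^m + q^(2m) =
  -- (1 - q^m)², the denominators.
  below-product : ∀ M → generating (below (2 ℕ.* M)) ⊠ oddProduct M -2P ≋ oddProduct M (const y)
  below-product zero    = P.trans (P.*-identityʳ _) below-zero
  below-product (suc M) = FactorRemoval.product-step seriesRing (below-product M)
    (P.trans (FactorRemoval.add-part-size seriesRing {X = const x} (P.-‿inverseʳ (P.1# ⊞ P.1#))
               (below-step M) (starting-step M) (designatedFirst-step M))
      (P.*-congˡ (P.+-congʳ (P.+-congˡ (P.*-congʳ (P.sym const-y))))))

  below-all : ∀ k n → n ℕ.≤ k → below k n ≡ PDO n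
  below-all k n n≤k = filter-all (head≤? k) (All.tabulate λ {λs} λs∈ → bound λs (to (∈-PDO n λs) λs∈))
    where
    bound : ∀ λs → IsPDOOf n λs → Head≤ k λs
    bound []             _          = tt
    bound ((p , _) ∷ λs) (_ , ≡.refl) = ℕ.≤-trans (ℕ.m≤m+n p (weight λs)) n≤k

  -- No part exceeds the weight, so up to weight 2N bounding the parts by 2N is no restriction.
  PDO-quotient : ∀ N → generating PDO ⊠ oddProduct N -2P ≋[ suc (N ℕ.+ N) ] oddProduct N (const y)
  PDO-quotient N = T.trans (T.*-congʳ {x = oddProduct N -2P} agree) (≋⇒≋[] K (below-product N))
    where
    K = suc (N ℕ.+ N)
    module T = CommutativeRing (truncated K)
    agree : generating PDO ≋[ K ] generating (below (2 ℕ.* N))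
    agree i i<K = S.reflexive (≡.cong (λ λss → ΣS.Σ[ λss ] term) (≡.sym (below-all (2 ℕ.* N) i
      (ℕ.≤-trans (ℕ.s≤s⁻¹ i<K) (ℕ.≤-reflexive (≡.cong (N ℕ.+_) (≡.sym (ℕ.+-identityʳ N))))))))

  PDO-even : (∀ s → s S.≈ S.- s → s S.≈ S.0#) → ∀ n → generating PDO (2 ℕ.* n) S.≈ (generating PDO ⊠ generating PDO) n
  PDO-even torsion-free = EvenPart.even-theta-quotient S torsion-free
    (Chebyshev.chebyshev-solves S y) S.refl PDO-quotient

-- From coefficient lists to power series in x

open PowerSeries ℤ.+-*-commutativeRing renaming (q to X) using (_≋_; _⊞_; _⊠_; seriesRing; q-⊠-zero; q-⊠-suc)
private
  module ℤ[[x]] = CommutativeRing seriesRing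
  module Σℤ = Sums seriesRing
open import Algebra.Properties.Semiring.Exp ℤ[[x]].semiring using (_^_)
open PDOProduct seriesRing X using (generating; PDO-even)

-- In ℤ⟦x⟧ the relation `p ≈ r` is literally `coeff p ≋ coeff r`, so the theorem may be proved over
-- ℤ⟦x⟧. This lemma and the next ones carry the operations across.
coeff-⊕ : ∀ p r → coeff (p ⊕ r) ≋ coeff p ⊞ coeff r
coeff-⊕ []      r       m       = ≡.sym (ℤ.+-identityˡ _)
coeff-⊕ (a ∷ p) []      m       = ≡.sym (ℤ.+-identityʳ _)
coeff-⊕ (a ∷ p) (b ∷ r) zero    = ≡.refl
coeff-⊕ (a ∷ p) (b ∷ r) (suc m) = coeff-⊕ p r m

coeff-scale : ∀ a p m → coeff (map (a ℤ.*_) p) m ≡ a ℤ.* coeff p m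
coeff-scale a []      m       = ≡.sym (ℤ.*-zeroʳ a)
coeff-scale a (b ∷ p) zero    = ≡.refl
coeff-scale a (b ∷ p) (suc m) = coeff-scale a p m

coeff-⊗ : ∀ p r → coeff (p ⊗ r) ≋ coeff p ⊠ coeff r
coeff-⊗ []      r m = ≡.sym (ℤ[[x]].zeroˡ (coeff r) m)
coeff-⊗ (a ∷ p) r m = ≡.trans (coeff-⊕ (map (a ℤ.*_) r) (0ℤ ∷ (p ⊗ r)) m)
  (≡.trans (≡.cong (ℤ._+ coeff (0ℤ ∷ (p ⊗ r)) m) (coeff-scale a r m)) (step m))
  where
  step : ∀ m → a ℤ.* coeff r m ℤ.+ coeff (0ℤ ∷ (p ⊗ r)) m ≡ (coeff (a ∷ p) ⊠ coeff r) m
  step zero    = ℤ.+-identityʳ _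
  step (suc m) = ≡.cong (λ c → a ℤ.* coeff r (suc m) ℤ.+ c) (coeff-⊗ p r m)

coeff-x^ : ∀ k → coeff (x^ k) ≋ X ^ k
coeff-x^ zero    zero    = ≡.refl
coeff-x^ zero    (suc m) = ≡.refl
coeff-x^ (suc k) zero    = ≡.sym (q-⊠-zero (X ^ k))
coeff-x^ (suc k) (suc m) = ≡.trans (coeff-x^ k m) (≡.sym (q-⊠-suc (X ^ k) m))

coeff-∑ : ∀ {A : Set} (as : List A) f → coeff (∑ as f) ≋ Σℤ.Σ[ as ] (coeff ∘ f)
coeff-∑ []       f m = ≡.refl
coeff-∑ (a ∷ as) f m = ≡.trans (coeff-⊕ (f a) (∑ as f) m) (≡.cong (λ c → coeff (f a) m ℤ.+ c) (coeff-∑ as f m))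

coeff-PDOSeries : ∀ n → coeff (PDOSeries n) ≋ generating PDO n
coeff-PDOSeries n = ℤ[[x]].trans (coeff-∑ (PDO n) (λ μ → x^ ℓd μ)) (Σℤ.Σ-cong (PDO n) (λ μ → coeff-x^ (ℓd μ)))

torsion-free : ∀ s → s ≋ ℤ[[x]].- s → s ≋ ℤ[[x]].0#
torsion-free s e m = self-negative (s m) (e m)
  where
  self-negative : ∀ i → i ≡ ℤ.- i → i ≡ 0ℤ
  self-negative (+ zero)  _  = ≡.refl
  self-negative (+ suc _) ()
  self-negative -[1+ _ ]  ()

PDOSeries-even : ∀ n → PDOSeries (2 * n) ≈ (PDOSeries ⊛ PDOSeries) n
PDOSeries-even n = begin
  coeff (PDOSeries (2 * n))              ≈⟨ coeff-PDOSeries (2 * n) ⟩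
  generating PDO (2 * n)                 ≈⟨ PDO-even torsion-free n ⟩
  Σℤ.diag n (λ a b → generating PDO a ⊠ generating PDO b)
    ≈⟨ Σℤ.diag-cong n (λ a b _ → ℤ[[x]].*-cong (ℤ[[x]].sym (coeff-PDOSeries a)) (ℤ[[x]].sym (coeff-PDOSeries b))) ⟩
  Σℤ.diag n (λ a b → coeff (PDOSeries a) ⊠ coeff (PDOSeries b))
    ≈⟨ Σℤ.diag-Σ n _ ⟩
  Σℤ.Σ[ upTo (suc n) ] (λ k → coeff (PDOSeries k) ⊠ coeff (PDOSeries (n ∸ k)))
    ≈⟨ Σℤ.Σ-cong (upTo (suc n)) (λ k → coeff-⊗ (PDOSeries k) (PDOSeries (n ∸ k))) ⟨
  Σℤ.Σ[ upTo (suc n) ] (λ k → coeff (PDOSeries k ⊗ PDOSeries (n ∸ k)))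
    ≈⟨ coeff-∑ (upTo (suc n)) (λ k → PDOSeries k ⊗ PDOSeries (n ∸ k)) ⟨
  coeff ((PDOSeries ⊛ PDOSeries) n)      ∎
  where open import Relation.Binary.Reasoning.Setoid ℤ[[x]].setoid

theorem1p3 : (n : ℕ) →
    (∑[ ρ ∈ PDO (2 * n) ] (x^ ℓd ρ)
    ≈ ∑[ k ∈ upTo (suc n) ] ((∑[ μ ∈ PDO k ] (x^ ℓd μ)) ⊗ (∑[ ν ∈ PDO (n ∸ k) ] (x^ ℓd ν))))
    × ([q^ (2 * n) ] PDOSeries ≈ [q^ n ] (PDOSeries ⊛ PDOSeries))
-- Both forms of the statement unfold to the same sums.
theorem1p3 n = PDOSeries-even n , PDOSeries-even n
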